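{- Let $\Pi_n$ be a permutation of $[n]=\{1,\dots,n\}$ chosen uniformly at random from all $n!$ permutations. Then there exist constants $c, C>0$ such that \[ \lim_{n\to\infty}{\mathds P}\left( c\,\frac{n^{2/3}}{(\log n)^{1/3}} \le t(\Pi_n) \le C\, n^{2/3}\right)=1, \] i.e. asymptotically almost surely $t(\Pi_n)=\Omega\!\left(n^{2/3}/\log^{1/3} n\right)$ and $t(\Pi_n)=O(n^{2/3})$.
   Context: A permutation is any finite sequence of distinct positive integers; an $n$-permutation is a permutation of $[n]$. Two permutations $(x_1,\dots,x_k)$ and $(y_1,\dots,y_k)$ are similar if $x_i<x_j \iff y_i<y_j$ for all $1\le i<j\le k$. For a permutation $\pi=(\pi(1),\dots,\pi(n))$, a sub-permutation is a subsequence $(\pi(i_1),\dots,\pi(i_k))$ with $i_1<\dots<i_k$. A pair of twins in $\pi$ is a pair of similar sub-permutations of $\pi$ whose index sets are disjoint; its length is the common number $k$ of entries of each of the two sub-permutations. $t(\pi)$ denotes the largest length of a pair of twins in $\pi$. -}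

module Defs where

open import Data.Nat using (ℕ; suc; _+_; _*_; _^_; _≤_; _<_; _!)
open import Data.Fin using (Fin) renaming (_<_ to _<ᶠ_)
open import Data.Vec using (Vec; lookup)
open import Data.List using (List; length; map)
open import Data.List.Relation.Unary.All using (All)
open import Data.List.Relation.Unary.Unique.Propositional using (Unique)
open import Data.Product using (Σ; ∃; _×_)
open import Relation.Binary.PropositionalEquality using (_≡_; _≢_)
open import Function.Bundles using (_⇔_)
open import Function.Definitions using (Injective)

-- An n-permutation, encoded as the sequence (π(0),…,π(n-1)) with values in
-- Fin n = {0,…,n-1} (a shift of [n] by one, irrelevant for similarity).
IsPerm : (n : ℕ) → Vec (Fin n) n → Set
IsPerm n π = Injective _≡_ _≡_ (lookup π)

Increasing : {n k : ℕ} → (Fin k → Fin n) → Set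
Increasing {n} {k} ι = ∀ (a b : Fin k) → a <ᶠ b → ι a <ᶠ ι b

record Twins {n : ℕ} (π : Vec (Fin n) n) (k : ℕ) : Set where
  field
    idx₁ idx₂ : Fin k → Fin n
    incr₁ : Increasing idx₁
    incr₂ : Increasing idx₂
    disjoint : ∀ (a b : Fin k) → idx₁ a ≢ idx₂ b
    similar : ∀ (a b : Fin k) → a <ᶠ b →
      (lookup π (idx₁ a) <ᶠ lookup π (idx₁ b)) ⇔ (lookup π (idx₂ a) <ᶠ lookup π (idx₂ b))

IsTwinNumber : {n : ℕ} → Vec (Fin n) n → ℕ → Set
IsTwinNumber π t = Twins π t × (∀ k → Twins π k → k ≤ t)

-- The event  (1/k) n^{2/3} / (log₂ n)^{1/3} ≤ t(π) ≤ C n^{2/3},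
-- cubed and exponentiated to stay in ℕ:
--   n² ≤ k³ t³ log₂ n  ⇔  2^(n²) ≤ n^(k³ t³),   and   t³ ≤ C³ n².
GoodEvent : (k C n : ℕ) → Vec (Fin n) n → Set
GoodEvent k C n π = ∃ λ t → IsTwinNumber π t ×
  (2 ^ (n ^ 2) ≤ n ^ (k ^ 3 * t ^ 3)) × (t ^ 3 ≤ C ^ 3 * n ^ 2)

-- P(GoodEvent) > 1 - 1/m for the uniform n-permutation: there are at least
-- |good| distinct n-permutations in the event, with m·(n! - |good|) < n!.
ProbAbove : (m n : ℕ) → (Vec (Fin n) n → Set) → Set
ProbAbove m n E = Σ (List (Vec (Fin n) n)) λ L →
  Unique L × All (IsPerm n) L × All E L × (m * (n ! Data.Nat.∸ length L) < n !)

{-# OPTIONS --safe #-}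

-- Upper bound, by the first moment method. If π has twins of length k on the index sequences I
-- and J, then permuting the values of π on J arbitrarily loses no information: I and J give back
-- the original order. Hence at most n²ᵏ n! / (k!)³ permutations have twins of length k, and this
-- is at most n! / 2ᵏ as soon as k³ ≥ 128 n².
--
-- Lower bound, even without the logarithm. Cut the values into blocks of length w ≈ n^{1/3} and
-- read π from left to right, pairing a value with an earlier one of the same block as soon as
-- possible; each pair must use a new block and start after the previous pair has ended. The first
-- entries of the pairs and the second entries are twins, because both are ordered as their blocks.
-- While few pairs have been found, the number s of distinct blocks met since the last pair grows,
-- or a pair is found, with probability at least 1/2; and when s has reached J ≈ n^{1/3}, a
-- pair is found with probability at least 1/(2J). So the weight 4^(pairs still wanted) (2J - s)
-- shrinks on average by the factor 1 - 1/(4J) per step, and after ≈ n steps it is exponentially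
-- small unless ≈ n^{2/3} pairs have been found.
module Submission where

open import Defs
open import Data.Bool using (if_then_else_)
open import Data.Fin using (Fin; zero; suc; toℕ; finToFun; funToFin; inject≤) renaming (_<_ to _<ᶠ_)
import Data.Fin.Properties as Fin
open import Data.Fin.Properties using (any?; all?)
open import Data.List using (List; []; _∷_; _++_; length; map; concatMap; filter; allFin; upTo; cartesianProduct)
import Data.List as List
import Data.List.Properties as List
open import Data.List.Membership.Propositional using (_∈_; _∉_; find; lose)
open import Data.List.Membership.Propositional.Properties
open import Data.List.Relation.Unary.All as All using (All; []; _∷_)
import Data.List.Relation.Unary.All.Properties as All
open import Data.List.Relation.Unary.AllPairs as AllPairs using (AllPairs; []; _∷_)
import Data.List.Relation.Unary.AllPairs.Properties as AllPairs
open import Data.List.Relation.Unary.Any as Any using (here; there)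
open import Data.List.Relation.Unary.Unique.Propositional using (Unique)
import Data.List.Relation.Unary.Unique.Propositional.Properties as Unique
open import Data.Nat using (ℕ; zero; suc; pred; _+_; _*_; _∸_; _^_; _/_; _%_; _!; _≤_; _<_; z≤n; s≤s; _≟_; _≤?_; _<?_; NonZero; >-nonZero)
open import Data.List.Membership.DecPropositional _≟_ using (_∈?_)
open import Data.Nat.DivMod using (m≡m%n+[m/n]*n; m%n<n; m/n*n≤m; /-monoˡ-≤; m<n*o⇒m/o<n)
open import Data.Nat.Induction using (<-wellFounded)
open import Data.Nat.Properties hiding (_≟_; _≤?_; _<?_)
open import Data.Nat.Tactic.RingSolver using (solve-∀)
open import Data.Product using (∃; _×_; _,_; proj₁; proj₂)
open import Data.Sum using (_⊎_; inj₁; inj₂)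
open import Data.Vec using (Vec; []; _∷_; lookup; tabulate)
import Data.Vec.Properties as Vec
open import Function using (_∘_; case_of_)
open import Function.Bundles using (_⇔_; mk⇔; Equivalence)
open import Function.Definitions using (Injective)
open import Induction.WellFounded using (Acc; acc)
open import Relation.Binary.Definitions using (tri<; tri≈; tri>)
open import Relation.Binary.PropositionalEquality
open import Relation.Nullary using (¬_; Dec; does; yes; no; contradiction; ¬?)
open import Relation.Nullary.Decidable using (map′; _×-dec_; _→-dec_)
open import Relation.Unary using (Decidable)

private variable
  A B : Set
  k n : ℕ

-- Finite sums

∑ : List A → (A → ℕ) → ℕ
∑ []       f = 0
∑ (x ∷ xs) f = f x + ∑ xs f

∑-mono : ∀ (xs : List A) {f g} → (∀ {x} → x ∈ xs → f x ≤ g x) → ∑ xs f ≤ ∑ xs g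
∑-mono []       f≤g = z≤n
∑-mono (x ∷ xs) f≤g = +-mono-≤ (f≤g (here refl)) (∑-mono xs (f≤g ∘ there))

∑-cong : ∀ (xs : List A) {f g} → (∀ x → f x ≡ g x) → ∑ xs f ≡ ∑ xs g
∑-cong []       f≡g = refl
∑-cong (x ∷ xs) f≡g = cong₂ _+_ (f≡g x) (∑-cong xs f≡g)

∑-cong-∈ : ∀ (xs : List A) {f g} → (∀ {x} → x ∈ xs → f x ≡ g x) → ∑ xs f ≡ ∑ xs g
∑-cong-∈ xs f≡g = ≤-antisym (∑-mono xs (≤-reflexive ∘ f≡g)) (∑-mono xs (≤-reflexive ∘ sym ∘ f≡g))

∑-distrib-+ : ∀ (xs : List A) f g → ∑ xs (λ x → f x + g x) ≡ ∑ xs f + ∑ xs g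
∑-distrib-+ []       f g = refl
∑-distrib-+ (x ∷ xs) f g rewrite ∑-distrib-+ xs f g = lem (f x) (g x) (∑ xs f) (∑ xs g)
  where
  lem : ∀ a b c d → a + b + (c + d) ≡ a + c + (b + d)
  lem = solve-∀

∑-distribʳ-* : ∀ (xs : List A) f c → ∑ xs (λ x → f x * c) ≡ ∑ xs f * c
∑-distribʳ-* []       f c = refl
∑-distribʳ-* (x ∷ xs) f c =
  trans (cong (f x * c +_) (∑-distribʳ-* xs f c)) (sym (*-distribʳ-+ c (f x) (∑ xs f)))

∑-const : ∀ (xs : List A) c → ∑ xs (λ _ → c) ≡ length xs * c
∑-const []       c = refl
∑-const (x ∷ xs) c = cong (c +_) (∑-const xs c)

∑-++ : ∀ (xs ys : List A) f → ∑ (xs ++ ys) f ≡ ∑ xs f + ∑ ys f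
∑-++ []       ys f = refl
∑-++ (x ∷ xs) ys f = trans (cong (f x +_) (∑-++ xs ys f)) (sym (+-assoc (f x) _ _))

∑-map : ∀ (g : A → B) xs f → ∑ (map g xs) f ≡ ∑ xs (f ∘ g)
∑-map g []       f = refl
∑-map g (x ∷ xs) f = cong (f (g x) +_) (∑-map g xs f)

∑-concatMap : ∀ (g : A → List B) xs f → ∑ (concatMap g xs) f ≡ ∑ xs (λ x → ∑ (g x) f)
∑-concatMap g []       f = refl
∑-concatMap g (x ∷ xs) f = trans (∑-++ (g x) _ f) (cong (∑ (g x) f +_) (∑-concatMap g xs f))

length-∑ : ∀ (xs : List A) → length xs ≡ ∑ xs (λ _ → 1)
length-∑ xs = sym (trans (∑-const xs 1) (*-identityʳ _))

ind : {P : Set} → Dec P → ℕ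
ind P? = if does P? then 1 else 0

ind≤1 : {P : Set} (P? : Dec P) → ind P? ≤ 1
ind≤1 (yes _) = s≤s z≤n
ind≤1 (no _)  = z≤n

ind-false : {P : Set} (P? : Dec P) → ¬ P → ind P? ≡ 0
ind-false (yes p) ¬p = contradiction p ¬p
ind-false (no _)  ¬p = refl

ind-mono : {P Q : Set} (P? : Dec P) (Q? : Dec Q) → (P → Q) → ind P? ≤ ind Q?
ind-mono (no _)  _       _   = z≤n
ind-mono (yes _) (yes _) _   = s≤s z≤n
ind-mono (yes p) (no ¬q) P⇒Q = contradiction (P⇒Q p) ¬q

ind-true : {P : Set} (P? : Dec P) → P → 1 ≤ ind P?
ind-true P? p = ind-mono (yes p) P? (λ p → p)

ind-subadditive : {P Q R : Set} (P? : Dec P) (Q? : Dec Q) (R? : Dec R) → (R → P ⊎ Q) →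
  ind R? ≤ ind P? + ind Q?
ind-subadditive P?      Q?      (no _)  _ = z≤n
ind-subadditive (yes _) Q?      (yes _) _ = s≤s z≤n
ind-subadditive (no ¬p) Q?      (yes r) f with f r
... | inj₁ p = contradiction p ¬p
... | inj₂ q = ind-mono (yes q) Q? (λ q → q)

ind-superadditive : {P Q R : Set} (P? : Dec P) (Q? : Dec Q) (R? : Dec R) →
  ¬ (P × Q) → (P ⊎ Q → R) → ind P? + ind Q? ≤ ind R?
ind-superadditive (yes p) (yes q) R? ¬pq f = contradiction (p , q) ¬pq
ind-superadditive (yes p) (no _)  R? ¬pq f = ind-mono (yes p) R? (f ∘ inj₁)
ind-superadditive (no _)  Q?      R? ¬pq f = ind-mono Q? R? (f ∘ inj₂)

length-filter-∑ : {P : A → Set} (P? : Decidable P) → ∀ xs → length (filter P? xs) ≡ ∑ xs (ind ∘ P?)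
length-filter-∑ P? []       = refl
length-filter-∑ P? (x ∷ xs) with P? x
... | yes _ = cong suc (length-filter-∑ P? xs)
... | no _  = length-filter-∑ P? xs

length-cartesianProduct : ∀ (xs : List A) (ys : List B) →
  length (cartesianProduct xs ys) ≡ length xs * length ys
length-cartesianProduct []       ys = refl
length-cartesianProduct (x ∷ xs) ys =
  trans (List.length-++ (map (x ,_) ys))
        (cong₂ _+_ (List.length-map (x ,_) ys) (length-cartesianProduct xs ys))

-- The injection is a relation, so that images may depend on choices made in a proof. Removing the
-- image of the head from `ys` loses no image of the tail, by injectivity and `Unique xs`.
length-≤-of-injection : (R : A → B → Set) (xs : List A) (ys : List B) → Unique xs →
  (∀ {x} → x ∈ xs → ∃ λ y → y ∈ ys × R x y) →
  (∀ {x x′ y} → x ∈ xs → x′ ∈ xs → R x y → R x′ y → x ≡ x′) →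
  length xs ≤ length ys
length-≤-of-injection R []       ys _ total inj = z≤n
length-≤-of-injection R (x ∷ xs) ys (x∉xs ∷ xs!) total inj
  with total (here refl)
... | y , y∈ys , Rxy with ∈-∃++ y∈ys
... | us , vs , refl = begin
  suc (length xs)          ≤⟨ s≤s (length-≤-of-injection R xs (us ++ vs) xs! total′
                                (λ p q → inj (there p) (there q))) ⟩
  suc (length (us ++ vs))  ≡⟨ List.length-++-sucʳ us y vs ⟨
  length (us ++ y ∷ vs)    ∎
  where
  open ≤-Reasoning
  total′ : ∀ {x′} → x′ ∈ xs → ∃ λ y′ → y′ ∈ us ++ vs × R x′ y′
  total′ x′∈xs with total (there x′∈xs)
  ... | y′ , y′∈ , Rx′y′ with ∈-++⁻ us y′∈
  ... | inj₁ y′∈us         = y′ , ∈-++⁺ˡ y′∈us , Rx′y′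
  ... | inj₂ (there y′∈vs) = y′ , ∈-++⁺ʳ us y′∈vs , Rx′y′
  ... | inj₂ (here refl)   =
    contradiction (inj (here refl) (there x′∈xs) Rxy Rx′y′) (All.lookup x∉xs x′∈xs)

-- Arrangements of a list and the enumeration of permutations

infixl 6 _-_

_-_ : List (Fin n) → Fin n → List (Fin n)
xs - v = filter (λ y → ¬? (v Fin.≟ y)) xs

∑-minus : ∀ {xs : List (Fin n)} {v} → Unique xs → v ∈ xs → ∀ f → ∑ xs f ≡ f v + ∑ (xs - v) f
∑-minus {xs = x ∷ xs} (x∉xs ∷ xs!) (here refl) f
  rewrite List.filter-reject (λ y → ¬? (x Fin.≟ y)) {xs = xs} (λ x≢x → x≢x refl)
        | List.filter-all (λ y → ¬? (x Fin.≟ y)) x∉xs = refl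
∑-minus {xs = x ∷ xs} {v} (x∉xs ∷ xs!) (there v∈xs) f
  rewrite List.filter-accept (λ y → ¬? (v Fin.≟ y)) {xs = xs} (≢-sym (All.lookup x∉xs v∈xs))
        | ∑-minus xs! v∈xs f
  = lem (f x) (f v) (∑ (xs - v) f)
  where
  lem : ∀ a b c → a + (b + c) ≡ b + (a + c)
  lem = solve-∀

length-minus : ∀ {xs : List (Fin n)} {v} → Unique xs → v ∈ xs → length xs ≡ suc (length (xs - v))
length-minus {xs = xs} {v} xs! v∈xs = begin
  length xs                      ≡⟨ length-∑ xs ⟩
  ∑ xs (λ _ → 1)                 ≡⟨ ∑-minus xs! v∈xs _ ⟩
  suc (∑ (xs - v) (λ _ → 1))     ≡⟨ cong suc (length-∑ (xs - v)) ⟨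
  suc (length (xs - v))          ∎
  where open ≡-Reasoning

minus-unique : ∀ {xs : List (Fin n)} {v} → Unique xs → Unique (xs - v)
minus-unique = Unique.filter⁺ _

-- Recursion on the first entry matches a scan from left to right: once the next value is fixed, the
-- arrangements of the values still to come remain.
arrangements : ∀ k → List (Fin n) → List (Vec (Fin n) k)
arrangements zero    xs = [] ∷ []
arrangements (suc k) xs = concatMap (λ v → map (v ∷_) (arrangements k (xs - v))) xs

-- The law of total expectation with respect to the first entry, without normalisation.
∑-arrangements : ∀ k (xs : List (Fin n)) f →
  ∑ (arrangements (suc k) xs) f ≡ ∑ xs (λ v → ∑ (arrangements k (xs - v)) (f ∘ (v ∷_)))
∑-arrangements k xs f =
  trans (∑-concatMap (λ v → map (v ∷_) (arrangements k (xs - v))) xs f)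
        (∑-cong xs (λ v → ∑-map (v ∷_) (arrangements k (xs - v)) f))

length-arrangements : ∀ k (xs : List (Fin n)) → Unique xs → length xs ≡ k →
  length (arrangements k xs) ≡ k !
length-arrangements zero    xs xs! eq = refl
length-arrangements (suc k) xs xs! eq = begin
  length (arrangements (suc k) xs)                       ≡⟨ length-∑ (arrangements (suc k) xs) ⟩
  ∑ (arrangements (suc k) xs) (λ _ → 1)                  ≡⟨ ∑-arrangements k xs _ ⟩
  ∑ xs (λ v → ∑ (arrangements k (xs - v)) (λ _ → 1))     ≡⟨ ∑-cong-∈ xs (λ {v} v∈ →
      trans (sym (length-∑ (arrangements k (xs - v))))
            (length-arrangements k (xs - v) (minus-unique xs!)
              (suc-injective (trans (sym (length-minus xs! v∈)) eq)))) ⟩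
  ∑ xs (λ _ → k !)                                       ≡⟨ ∑-const xs (k !) ⟩
  length xs * k !                                        ≡⟨ cong (_* k !) eq ⟩
  suc k * k !                                            ∎
  where open ≡-Reasoning

∈-arrangements⁻ : ∀ k (xs : List (Fin n)) {vs} → vs ∈ arrangements k xs →
  (∀ a → lookup vs a ∈ xs) × Injective _≡_ _≡_ (lookup vs)
∈-arrangements⁻ zero    xs vs∈ = (λ ()) , λ {}
∈-arrangements⁻ (suc k) xs vs∈
  with find (∈-concatMap⁻ (λ v → map (v ∷_) (arrangements k (xs - v))) {xs = xs} vs∈)
... | v , v∈xs , vs∈map with ∈-map⁻ (v ∷_) vs∈map
... | ws , ws∈ , refl = member , injective
  where
  ih = ∈-arrangements⁻ k (xs - v) ws∈
  tail∈ : ∀ a → lookup ws a ∈ xs × v ≢ lookup ws a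
  tail∈ a = ∈-filter⁻ (λ y → ¬? (v Fin.≟ y)) (proj₁ ih a)
  member : ∀ a → lookup (v ∷ ws) a ∈ xs
  member zero    = v∈xs
  member (suc a) = proj₁ (tail∈ a)
  injective : Injective _≡_ _≡_ (lookup (v ∷ ws))
  injective {zero}  {zero}  eq = refl
  injective {zero}  {suc b} eq = contradiction eq (proj₂ (tail∈ b))
  injective {suc a} {zero}  eq = contradiction (sym eq) (proj₂ (tail∈ a))
  injective {suc a} {suc b} eq = cong suc (proj₂ ih eq)

∈-arrangements⁺ : ∀ k (xs : List (Fin n)) {vs} → (∀ a → lookup vs a ∈ xs) →
  Injective _≡_ _≡_ (lookup vs) → vs ∈ arrangements k xs
∈-arrangements⁺ zero    xs {[]}     member injective = here refl
∈-arrangements⁺ (suc k) xs {v ∷ ws} member injective =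
  ∈-concatMap⁺ (λ u → map (u ∷_) (arrangements k (xs - u))) (lose (member zero) (∈-map⁺ (v ∷_)
    (∈-arrangements⁺ k (xs - v)
      (λ a → ∈-filter⁺ (λ y → ¬? (v Fin.≟ y)) (member (suc a)) (λ eq → Fin.0≢1+n (injective eq)))
      (Fin.suc-injective ∘ injective))))

arrangements-unique : ∀ k (xs : List (Fin n)) → Unique xs → Unique (arrangements k xs)
arrangements-unique zero    xs xs! = [] ∷ []
arrangements-unique (suc k) xs xs! = Unique.concat⁺
  (All.map⁺ (All.tabulate λ {v} _ → Unique.map⁺ (λ { refl → refl })
    (arrangements-unique k (xs - v) (minus-unique xs!))))
  (AllPairs.map⁺ (AllPairs.map disjoint xs!))
  where
  disjoint : ∀ {u v} → u ≢ v → ∀ {ws} → ¬ (ws ∈ map (u ∷_) (arrangements k (xs - u)) ×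
                                            ws ∈ map (v ∷_) (arrangements k (xs - v)))
  disjoint u≢v (p , q) with ∈-map⁻ _ p | ∈-map⁻ _ q
  ... | _ , _ , refl | _ , _ , refl = u≢v refl

perms : ∀ n → List (Vec (Fin n) n)
perms n = arrangements n (allFin n)

length-perms : ∀ n → length (perms n) ≡ n !
length-perms n = length-arrangements n (allFin n) (Unique.allFin⁺ n) (List.length-tabulate (λ i → i))

perms-unique : ∀ n → Unique (perms n)
perms-unique n = arrangements-unique n (allFin n) (Unique.allFin⁺ n)

∈-perms⁻ : ∀ {π} → π ∈ perms n → IsPerm n π
∈-perms⁻ {n} π∈ = proj₂ (∈-arrangements⁻ n (allFin n) π∈)

∈-perms⁺ : ∀ {π} → IsPerm n π → π ∈ perms n
∈-perms⁺ {n} = ∈-arrangements⁺ n (allFin n) (λ a → ∈-allFin _)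

-- Counting permutations with long twins

-- A missed value `b` could be punched out, which would leave an injection into a smaller finite
-- set.
injective⇒surjective : {σ : Fin k → Fin k} → Injective _≡_ _≡_ σ → ∀ b → ∃ λ a → σ a ≡ b
injective⇒surjective {suc k} {σ} σ-inj b with any? (λ a → σ a Fin.≟ b)
... | yes p = p
... | no ¬p = contradiction (λ {i} {j} → σ-inj ∘ Fin.punchOut-injective (b≢σ i) (b≢σ j))
                            (Fin.<⇒notInjective (n<1+n k))
  where
  b≢σ : ∀ a → b ≢ σ a
  b≢σ a eq = ¬p (a , sym eq)

-- The relabelling is its own witness of an infinite descent: if f′ drops from τ′ a to τ a, then
-- it drops from τ′ a₁ to τ a₁ as well, where τ′ a₁ = τ a.
relabelling-¬< : (f f′ : Fin k → Fin n) {τ τ′ : Fin k → Fin k} → Injective _≡_ _≡_ τ′ →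
  (∀ a b → f a <ᶠ f b → f′ a <ᶠ f′ b) → (∀ a → f (τ a) ≡ f′ (τ′ a)) →
  ∀ a → ¬ (f′ (τ a) <ᶠ f′ (τ′ a))
relabelling-¬< f f′ {τ} {τ′} τ′-inj mono eq a = go a (<-wellFounded _)
  where
  go : ∀ a → Acc _<_ (toℕ (f′ (τ′ a))) → ¬ (f′ (τ a) <ᶠ f′ (τ′ a))
  go a (acc rec) lt with injective⇒surjective τ′-inj (τ a)
  ... | a₁ , τ′a₁≡τa = go a₁ (rec (subst (_<ᶠ f′ (τ′ a)) (sym eq₁) lt))
      (subst (f′ (τ a₁) <ᶠ_) (sym eq₁) (mono _ _ (subst₂ _<ᶠ_ (sym (trans (eq a₁) eq₁)) (sym (eq a)) lt)))
    where
    eq₁ : f′ (τ′ a₁) ≡ f′ (τ a)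
    eq₁ = cong f′ τ′a₁≡τa

-- If `f′` differs at `τ a` and `τ′ a`, either strict inequality starts the descent of
-- `relabelling-¬<`, in the second case with the roles of `f` and `f′` exchanged.
relabelling-unique : (f f′ : Fin k → Fin n) {τ τ′ : Fin k → Fin k} →
  Injective _≡_ _≡_ τ → Injective _≡_ _≡_ τ′ → Injective _≡_ _≡_ f′ →
  (∀ a b → f a <ᶠ f b → f′ a <ᶠ f′ b) → (∀ a b → f′ a <ᶠ f′ b → f a <ᶠ f b) →
  (∀ a → f (τ a) ≡ f′ (τ′ a)) → ∀ a → τ a ≡ τ′ a
relabelling-unique f f′ {τ} {τ′} τ-inj τ′-inj f′-inj to from eq a with Fin.<-cmp (f′ (τ a)) (f′ (τ′ a))
... | tri< lt _ _ = contradiction lt (relabelling-¬< f f′ τ′-inj to eq a)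
... | tri≈ _ eq′ _ = f′-inj eq′
... | tri> _ _ gt = contradiction (from _ _ gt) (relabelling-¬< f′ f τ-inj from (sym ∘ eq) a)

-- Similarity speaks only of `a <ᶠ b`. For `b <ᶠ a`, trichotomy of the values of `f′` leaves the
-- wanted inequality: injectivity excludes equality and similarity the reverse order.
order-transfer : (f f′ : Fin k → Fin n) → Injective _≡_ _≡_ f′ →
  (∀ a b → a <ᶠ b → (f a <ᶠ f b) ⇔ (f′ a <ᶠ f′ b)) → ∀ a b → f a <ᶠ f b → f′ a <ᶠ f′ b
order-transfer f f′ f′-inj same a b lt with Fin.<-cmp a b
... | tri< a<b _ _ = Equivalence.to (same a b a<b) lt
... | tri≈ _ refl _ = contradiction lt (Fin.<-irrefl refl)
... | tri> _ a≢b b<a with Fin.<-cmp (f′ a) (f′ b)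
...   | tri< lt′ _ _ = lt′
...   | tri≈ _ eq _ = contradiction (f′-inj eq) a≢b
...   | tri> _ _ gt = contradiction (Equivalence.from (same b a b<a) gt) (Fin.<-asym lt)

increasing⇒injective : {ι : Fin k → Fin n} → Increasing ι → Injective _≡_ _≡_ ι
increasing⇒injective ι-incr {a} {b} eq with Fin.<-cmp a b
... | tri< a<b _ _ = contradiction (ι-incr a b a<b) (Fin.<-irrefl eq)
... | tri≈ _ a≡b _ = a≡b
... | tri> _ _ b<a = contradiction (ι-incr b a b<a) (Fin.<-irrefl (sym eq))

-- Increasing sequences are ordered alike, so `relabelling-unique` applies. This recovers both an
-- index sequence and its shuffle from the shuffled sequence.
increasing-unique : {ι ι′ : Fin k → Fin n} {τ τ′ : Fin k → Fin k} → Increasing ι → Increasing ι′ →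
  Injective _≡_ _≡_ τ → Injective _≡_ _≡_ τ′ → (∀ a → ι (τ a) ≡ ι′ (τ′ a)) →
  (∀ a → τ a ≡ τ′ a) × (∀ a → ι a ≡ ι′ a)
increasing-unique {ι = ι} {ι′} {τ} {τ′} incr incr′ τ-inj τ′-inj eq = τ≗τ′ , ι≗ι′
  where
  transfer : ∀ {ι ι′ : Fin _ → Fin _} → Increasing ι → Increasing ι′ → ∀ a b → ι a <ᶠ ι b → ι′ a <ᶠ ι′ b
  transfer {ι} {ι′} incr incr′ = order-transfer ι ι′ (increasing⇒injective incr′)
    (λ a b a<b → mk⇔ (λ _ → incr′ a b a<b) (λ _ → incr a b a<b))
  τ≗τ′ : ∀ a → τ a ≡ τ′ a
  τ≗τ′ = relabelling-unique ι ι′ τ-inj τ′-inj (increasing⇒injective incr′)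
    (transfer incr incr′) (transfer incr′ incr) eq
  ι≗ι′ : ∀ a → ι a ≡ ι′ a
  ι≗ι′ a with injective⇒surjective τ-inj a
  ... | c , refl = trans (eq c) (cong ι′ (sym (τ≗τ′ c)))

module Along (J : Fin k → Fin n) (J-inj : Injective _≡_ _≡_ J) (σ : Fin k → Fin k) where

  permuted : Fin n → Fin n
  permuted i with any? (λ a → J a Fin.≟ i)
  ... | yes (a , _) = J (σ a)
  ... | no _        = i

  permuted-on : ∀ a → permuted (J a) ≡ J (σ a)
  permuted-on a with any? (λ b → J b Fin.≟ J a)
  ... | yes (b , eq) = cong (J ∘ σ) (J-inj eq)
  ... | no ¬p        = contradiction (a , refl) ¬p

  permuted-off : ∀ i → (∀ a → i ≢ J a) → permuted i ≡ i
  permuted-off i i∉J with any? (λ b → J b Fin.≟ i)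
  ... | yes (b , eq) = contradiction (sym eq) (i∉J b)
  ... | no _         = refl

  permuted-injective : Injective _≡_ _≡_ σ → Injective _≡_ _≡_ permuted
  permuted-injective σ-inj {i} {j} eq with any? (λ b → J b Fin.≟ i) | any? (λ b → J b Fin.≟ j)
  ... | yes (a , refl) | yes (b , refl) = cong J (σ-inj (J-inj eq))
  ... | yes (a , _) | no ¬q      = contradiction (σ a , eq) ¬q
  ... | no ¬p | yes (b , _)      = contradiction (σ b , sym eq) ¬p
  ... | no _ | no _              = eq

vec-ext : {A : Set} {u v : Vec A n} → (∀ i → lookup u i ≡ lookup v i) → u ≡ v
vec-ext {u = u} {v} eq = trans (sym (Vec.tabulate∘lookup u)) (trans (Vec.tabulate-cong eq) (Vec.tabulate∘lookup v))

-- Scrambles a permutation with twins of length k by three permutations of [k]: two shuffle the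
-- index sequences, the third shuffles the values of the second twin. Nothing is lost, because
-- index sequences are increasing and the second twin has to be ordered like the first.
record Scrambles {n k} (π : Vec (Fin n) n) (α β σ : Vec (Fin k) k) (u v : Fin (n ^ k)) (ρ : Vec (Fin n) n) : Set where
  field
    twins : Twins π k
  open Twins twins public
  field
    eq₁ : ∀ a → idx₁ (lookup α a) ≡ finToFun u a
    eq₂ : ∀ a → idx₂ (lookup β a) ≡ finToFun v a
    on  : ∀ a → lookup π (idx₂ (lookup σ a)) ≡ lookup ρ (idx₂ a)
    off : ∀ i → (∀ a → i ≢ idx₂ a) → lookup π i ≡ lookup ρ i

-- `u` and `v` code the shuffled index sequences as numbers below `n ^ k`; `ρ` is `π` composed with
-- the permutation of positions that moves `idx₂ a` to `idx₂ (lookup σ a)`.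
scramble : {π : Vec (Fin n) n} {α β σ : Vec (Fin k) k} → IsPerm n π → Twins π k → IsPerm k σ →
  ∃ λ u → ∃ λ v → ∃ λ ρ → IsPerm n ρ × Scrambles π α β σ u v ρ
scramble {n} {k} {π} {α} {β} {σ} π-inj tw σ-inj =
  funToFin (idx₁ ∘ lookup α) , funToFin (idx₂ ∘ lookup β) , tabulate (lookup π ∘ permuted) , ρ-inj ,
  record
    { twins = tw
    ; eq₁ = λ a → sym (Fin.finToFun-funToFin (idx₁ ∘ lookup α) a)
    ; eq₂ = λ a → sym (Fin.finToFun-funToFin (idx₂ ∘ lookup β) a)
    ; on  = λ a → sym (trans (Vec.lookup∘tabulate _ (idx₂ a)) (cong (lookup π) (permuted-on a)))
    ; off = λ i i∉ → sym (trans (Vec.lookup∘tabulate _ i) (cong (lookup π) (permuted-off i i∉)))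
    }
  where
  open Twins tw
  open Along idx₂ (increasing⇒injective incr₂) (lookup σ)
  ρ-inj : IsPerm n (tabulate (lookup π ∘ permuted))
  ρ-inj {i} {j} eq = permuted-injective σ-inj (π-inj
    (trans (sym (Vec.lookup∘tabulate _ i)) (trans eq (Vec.lookup∘tabulate _ j))))

-- Decoding goes in stages. `u` and `v` yield the index sequences, `α` and `β`. Off the second
-- sequence `π` agrees with `ρ`, hence on the first one, by disjointness. The first twin prescribes
-- the order of the second; with the shuffled values in `ρ` this determines `σ`, and then `π` on the
-- second sequence.
scrambles-injective : {π π′ ρ : Vec (Fin n) n} {α α′ β β′ σ σ′ : Vec (Fin k) k} {u v : Fin (n ^ k)} →
  IsPerm n π → IsPerm n π′ → IsPerm k α → IsPerm k α′ → IsPerm k β → IsPerm k β′ → IsPerm k σ → IsPerm k σ′ →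
  Scrambles π α β σ u v ρ → Scrambles π′ α′ β′ σ′ u v ρ →
  π ≡ π′ × α ≡ α′ × β ≡ β′ × σ ≡ σ′
scrambles-injective {n} {k} {π} {π′} {ρ} {α} {α′} {β} {β′} {σ} {σ′} π! π′! α! α′! β! β′! σ! σ′! s s′ =
  vec-ext π≗π′ , vec-ext (proj₁ first) , vec-ext (proj₁ second) , vec-ext σ≗σ′
  where
  module S = Scrambles s
  module S′ = Scrambles s′
  first : (∀ a → lookup α a ≡ lookup α′ a) × (∀ a → S.idx₁ a ≡ S′.idx₁ a)
  first = increasing-unique S.incr₁ S′.incr₁ α! α′! (λ a → trans (S.eq₁ a) (sym (S′.eq₁ a)))
  second : (∀ a → lookup β a ≡ lookup β′ a) × (∀ a → S.idx₂ a ≡ S′.idx₂ a)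
  second = increasing-unique S.incr₂ S′.incr₂ β! β′! (λ a → trans (S.eq₂ a) (sym (S′.eq₂ a)))
  off : ∀ i → (∀ a → i ≢ S.idx₂ a) → lookup π i ≡ lookup π′ i
  off i i∉ = trans (S.off i i∉) (sym (S′.off i (λ a eq → i∉ a (trans eq (sym (proj₂ second a))))))
  f f′ g g′ : Fin k → Fin n
  f  = lookup π ∘ S.idx₂
  f′ = lookup π′ ∘ S′.idx₂
  g  = lookup π ∘ S.idx₁
  g′ = lookup π′ ∘ S′.idx₁
  g≗g′ : ∀ a → g a ≡ g′ a
  g≗g′ a = trans (off _ (S.disjoint a)) (cong (lookup π′) (proj₂ first a))
  f-inj : Injective _≡_ _≡_ f
  f-inj = increasing⇒injective S.incr₂ ∘ π!
  f′-inj : Injective _≡_ _≡_ f′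
  f′-inj = increasing⇒injective S′.incr₂ ∘ π′!
  same : ∀ a b → a <ᶠ b → (f a <ᶠ f b) ⇔ (f′ a <ᶠ f′ b)
  same a b a<b = mk⇔
    (λ lt → Equivalence.to (S′.similar a b a<b) (subst₂ _<ᶠ_ (g≗g′ a) (g≗g′ b) (Equivalence.from (S.similar a b a<b) lt)))
    (λ lt → Equivalence.to (S.similar a b a<b) (subst₂ _<ᶠ_ (sym (g≗g′ a)) (sym (g≗g′ b)) (Equivalence.from (S′.similar a b a<b) lt)))
  same′ : ∀ a b → a <ᶠ b → (f′ a <ᶠ f′ b) ⇔ (f a <ᶠ f b)
  same′ a b a<b = mk⇔ (Equivalence.from (same a b a<b)) (Equivalence.to (same a b a<b))
  σ≗σ′ : ∀ a → lookup σ a ≡ lookup σ′ a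
  -- Read along the second index sequence, `f` after `σ` and `f′` after `σ′` both equal `ρ`.
  σ≗σ′ = relabelling-unique f f′ σ! σ′! f′-inj (order-transfer f f′ f′-inj same) (order-transfer f′ f f-inj same′)
    (λ a → trans (S.on a) (trans (cong (lookup ρ) (proj₂ second a)) (sym (S′.on a))))
  on : ∀ a → lookup π (S.idx₂ a) ≡ lookup π′ (S.idx₂ a)
  on a with injective⇒surjective σ! a
  ... | c , refl = begin
    lookup π (S.idx₂ (lookup σ c))     ≡⟨ S.on c ⟩
    lookup ρ (S.idx₂ c)                ≡⟨ cong (lookup ρ) (proj₂ second c) ⟩
    lookup ρ (S′.idx₂ c)               ≡⟨ S′.on c ⟨
    lookup π′ (S′.idx₂ (lookup σ′ c))  ≡⟨ cong (lookup π′ ∘ S′.idx₂) (σ≗σ′ c) ⟨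
    lookup π′ (S′.idx₂ (lookup σ c))   ≡⟨ cong (lookup π′) (proj₂ second _) ⟨
    lookup π′ (S.idx₂ (lookup σ c))    ∎
    where open ≡-Reasoning
  π≗π′ : ∀ i → lookup π i ≡ lookup π′ i
  π≗π′ i with any? (λ a → i Fin.≟ S.idx₂ a)
  ... | yes (a , refl) = on a
  ... | no ¬p          = off i (λ a eq → ¬p (a , eq))

-- Each permutation with twins is combined with three independent permutations of `Fin k`, whence
-- three factors `k !`; the two codes and the scrambled permutation give the right-hand side.
count-twins : (twins? : Decidable (λ (π : Vec (Fin n) n) → Twins π k)) →
  length (filter twins? (perms n)) * (k ! * (k ! * k !)) ≤ n ^ k * (n ^ k * n !)
count-twins {n} {k} twins? = subst₂ _≤_ lhs rhs
  (length-≤-of-injection R (cartesianProduct L (cartesianProduct Pₖ (cartesianProduct Pₖ Pₖ)))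
     (cartesianProduct F (cartesianProduct F (perms n)))
     (Unique.cartesianProduct⁺ (Unique.filter⁺ twins? (perms-unique n))
       (Unique.cartesianProduct⁺ Pₖ! (Unique.cartesianProduct⁺ Pₖ! Pₖ!)))
     total injective)
  where
  L = filter twins? (perms n)
  Pₖ = perms k
  Pₖ! = perms-unique k
  F = allFin (n ^ k)
  R : Vec (Fin n) n × Vec (Fin k) k × Vec (Fin k) k × Vec (Fin k) k →
      Fin (n ^ k) × Fin (n ^ k) × Vec (Fin n) n → Set
  R (π , α , β , σ) (u , v , ρ) = Scrambles π α β σ u v ρ
  lhs : length (cartesianProduct L (cartesianProduct Pₖ (cartesianProduct Pₖ Pₖ))) ≡ length L * (k ! * (k ! * k !))
  lhs rewrite length-cartesianProduct L (cartesianProduct Pₖ (cartesianProduct Pₖ Pₖ))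
            | length-cartesianProduct Pₖ (cartesianProduct Pₖ Pₖ)
            | length-cartesianProduct Pₖ Pₖ | length-perms k = refl
  rhs : length (cartesianProduct F (cartesianProduct F (perms n))) ≡ n ^ k * (n ^ k * n !)
  rhs rewrite length-cartesianProduct F (cartesianProduct F (perms n))
            | length-cartesianProduct F (perms n)
            | List.length-tabulate {n = n ^ k} (λ i → i) | length-perms n = refl
  split : ∀ {x} → x ∈ cartesianProduct L (cartesianProduct Pₖ (cartesianProduct Pₖ Pₖ)) →
          let (π , α , β , σ) = x in (IsPerm n π × Twins π k) × IsPerm k α × IsPerm k β × IsPerm k σ
  split x∈ =
    let π∈ , y∈ = ∈-cartesianProduct⁻ L _ x∈
        α∈ , z∈ = ∈-cartesianProduct⁻ Pₖ _ y∈
        β∈ , σ∈ = ∈-cartesianProduct⁻ Pₖ Pₖ z∈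
        π∈perms , tw = ∈-filter⁻ twins? π∈
    in (∈-perms⁻ π∈perms , tw) , ∈-perms⁻ α∈ , ∈-perms⁻ β∈ , ∈-perms⁻ σ∈
  total : ∀ {x} → x ∈ cartesianProduct L (cartesianProduct Pₖ (cartesianProduct Pₖ Pₖ)) →
          ∃ λ y → y ∈ cartesianProduct F (cartesianProduct F (perms n)) × R x y
  total x∈ =
    let (π! , tw) , _ , _ , σ! = split x∈
        u , v , ρ , ρ! , s = scramble π! tw σ!
    in (u , v , ρ) , ∈-cartesianProduct⁺ (∈-allFin u) (∈-cartesianProduct⁺ (∈-allFin v) (∈-perms⁺ ρ!)) , s
  injective : ∀ {x x′ y} → x ∈ cartesianProduct L (cartesianProduct Pₖ (cartesianProduct Pₖ Pₖ)) →
    x′ ∈ cartesianProduct L (cartesianProduct Pₖ (cartesianProduct Pₖ Pₖ)) → R x y → R x′ y → x ≡ x′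
  injective x∈ x′∈ s s′ with split x∈ | split x′∈
  ... | (π! , _) , α! , β! , σ! | (π′! , _) , α′! , β′! , σ′!
    with scrambles-injective π! π′! α! α′! β! β′! σ! σ′! s s′
  ... | refl , refl , refl , refl = refl

-- Deciding twins, and the size of factorials

private
  TwinPair : Vec (Fin n) n → (k : ℕ) → (Fin k → Fin n) → (Fin k → Fin n) → Set
  TwinPair π k f g = Increasing f × Increasing g × (∀ a b → f a ≢ g b) ×
    (∀ a b → a <ᶠ b → (lookup π (f a) <ᶠ lookup π (f b)) ⇔ (lookup π (g a) <ᶠ lookup π (g b)))

  increasing? : (f : Fin k → Fin n) → Dec (Increasing f)
  increasing? f = all? λ a → all? λ b → (a Fin.<? b) →-dec (f a Fin.<? f b)

  twinPair? : (π : Vec (Fin n) n) → ∀ k f g → Dec (TwinPair π k f g)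
  twinPair? π k f g = increasing? f ×-dec increasing? g ×-dec
    (all? λ a → all? λ b → ¬? (f a Fin.≟ g b)) ×-dec
    (all? λ a → all? λ b → (a Fin.<? b) →-dec
      iff? (lookup π (f a) Fin.<? lookup π (f b)) (lookup π (g a) Fin.<? lookup π (g b)))
    where
    iff? : {P Q : Set} → Dec P → Dec Q → Dec (P ⇔ Q)
    iff? P? Q? = map′ (λ (to , from) → mk⇔ to from) (λ e → Equivalence.to e , Equivalence.from e)
      ((P? →-dec Q?) ×-dec (Q? →-dec P?))

  increasing-resp : {f f′ : Fin k → Fin n} → (∀ a → f a ≡ f′ a) → Increasing f → Increasing f′
  increasing-resp eq incr a b a<b = subst₂ _<ᶠ_ (eq a) (eq b) (incr a b a<b)

  twinPair-resp : (π : Vec (Fin n) n) {f f′ g g′ : Fin k → Fin n} → (∀ a → f a ≡ f′ a) → (∀ a → g a ≡ g′ a) →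
    TwinPair π k f g → TwinPair π k f′ g′
  twinPair-resp π eq eq′ (incr , incr′ , disj , sim) =
    increasing-resp eq incr , increasing-resp eq′ incr′ ,
    (λ a b p → disj a b (trans (eq a) (trans p (sym (eq′ b))))) ,
    (λ a b a<b → subst₂ _⇔_
      (cong₂ (λ x y → lookup π x <ᶠ lookup π y) (eq a) (eq b))
      (cong₂ (λ x y → lookup π x <ᶠ lookup π y) (eq′ a) (eq′ b))
      (sim a b a<b))

-- Functions `Fin k → Fin n` are searched through their codes in `Fin (n ^ k)`. A decoded function
-- agrees with the original only pointwise, hence the transport by `twinPair-resp`.
twins? : ∀ k → Decidable (λ (π : Vec (Fin n) n) → Twins π k)
twins? {n} k π = map′ to from
  (any? λ u → any? λ v → twinPair? π k (finToFun u) (finToFun v))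
  where
  to : (∃ λ u → ∃ λ v → TwinPair π k (finToFun {n} {k} u) (finToFun {n} {k} v)) → Twins π k
  to (u , v , incr , incr′ , disj , sim) = record
    { idx₁ = finToFun u ; idx₂ = finToFun v ; incr₁ = incr ; incr₂ = incr′ ; disjoint = disj ; similar = sim }
  from : Twins π k → ∃ λ u → ∃ λ v → TwinPair π k (finToFun {n} {k} u) (finToFun {n} {k} v)
  from tw = funToFin idx₁ , funToFin idx₂ ,
    twinPair-resp π (sym ∘ Fin.finToFun-funToFin idx₁) (sym ∘ Fin.finToFun-funToFin idx₂)
      (incr₁ , incr₂ , disjoint , similar)
    where open Twins tw

-- By restriction to the first `k` entries; thus excluding one length excludes all larger ones.
twins-shorten : {π : Vec (Fin n) n} {k t : ℕ} → k ≤ t → Twins π t → Twins π k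
twins-shorten {n} {π} {k} {t} k≤t tw = record
  { idx₁ = idx₁ ∘ ι ; idx₂ = idx₂ ∘ ι
  ; incr₁ = λ a b a<b → incr₁ (ι a) (ι b) (ι-mono a<b)
  ; incr₂ = λ a b a<b → incr₂ (ι a) (ι b) (ι-mono a<b)
  ; disjoint = λ a b → disjoint (ι a) (ι b)
  ; similar = λ a b a<b → similar (ι a) (ι b) (ι-mono a<b)
  }
  where
  open Twins tw
  ι : Fin k → Fin t
  ι a = inject≤ a k≤t
  ι-mono : ∀ {a b} → a <ᶠ b → ι a <ᶠ ι b
  ι-mono {a} {b} = subst₂ _<_ (sym (Fin.toℕ-inject≤ a k≤t)) (sym (Fin.toℕ-inject≤ b k≤t))

greatest : {P : ℕ → Set} (P? : Decidable P) → P 0 → ∀ n → (∀ k → P k → k ≤ n) →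
  ∃ λ t → P t × (∀ k → P k → k ≤ t)
greatest P? P0 zero    bound = 0 , P0 , bound
greatest P? P0 (suc n) bound with P? (suc n)
... | yes p = suc n , p , bound
... | no ¬p = greatest P? P0 n λ k Pk → case m≤n⇒m<n∨m≡n (bound k Pk) of λ
  { (inj₁ k<1+n) → ≤-pred k<1+n
  ; (inj₂ refl)  → contradiction Pk ¬p
  }

twinNumber : (π : Vec (Fin n) n) → ∃ (IsTwinNumber π)
twinNumber {n} π = greatest (λ k → twins? k π) empty n
  (λ k tw → Fin.injective⇒≤ (increasing⇒injective (Twins.incr₁ tw)))
  where
  empty : Twins π 0
  empty = record { idx₁ = λ () ; idx₂ = λ () ; incr₁ = λ () ; incr₂ = λ () ; disjoint = λ () ; similar = λ () }

-- The product of `k + 1` up to `k + j`, which is `j !` times the binomial coefficient of `k + j`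
-- over `j`.
rising : ℕ → ℕ → ℕ
rising zero    k = 1
rising (suc j) k = suc k * rising j (suc k)

rising-last : ∀ j k → rising (suc j) k ≡ rising j k * suc (k + j)
rising-last zero    k rewrite +-identityʳ k = *-comm (suc k) 1
rising-last (suc j) k = begin
  suc k * (rising (suc j) (suc k))                 ≡⟨ cong (suc k *_) (rising-last j (suc k)) ⟩
  suc k * (rising j (suc k) * suc (suc k + j))     ≡⟨ *-assoc (suc k) (rising j (suc k)) _ ⟨
  suc k * rising j (suc k) * suc (suc k + j)       ≡⟨ cong (λ x → suc k * rising j (suc k) * suc x) (+-suc k j) ⟨
  suc k * rising j (suc k) * suc (k + suc j)       ∎
  where open ≡-Reasoning

^≤rising : ∀ j k → k ^ j ≤ rising j k
^≤rising zero    k = ≤-refl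
^≤rising (suc j) k = *-mono-≤ (n≤1+n k) (≤-trans (^-monoˡ-≤ j (n≤1+n k)) (^≤rising j (suc k)))

-- Pascal's rule for the binomial coefficient rising j k / j !.
rising-pascal : ∀ j k → rising (suc j) (suc k) ≡ rising (suc j) k + suc j * rising j (suc k)
rising-pascal j k = trans (rising-last j (suc k)) (lem k j (rising j (suc k)))
  where
  lem : ∀ k j x → x * suc (suc k + j) ≡ suc k * x + suc j * x
  lem = solve-∀

-- Pascal's rule splits the binomial coefficient `rising j k / j !` into two earlier ones, each at
-- most half of `2 ^ (j + k)`.
rising≤ : ∀ j k → rising j k ≤ 2 ^ (j + k) * j !
rising≤ zero k = *-mono-≤ (m^n>0 2 k) (≤-refl {1})
rising≤ (suc j) zero = begin
  1 * rising j 1                        ≡⟨ *-identityˡ _ ⟩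
  rising j 1                            ≤⟨ rising≤ j 1 ⟩
  2 ^ (j + 1) * j !                     ≡⟨ cong (λ x → 2 ^ x * j !) (trans (+-comm j 1) (sym (+-identityʳ (suc j)))) ⟩
  2 ^ (suc j + 0) * j !                 ≤⟨ *-monoʳ-≤ (2 ^ (suc j + 0)) (m≤m+n (j !) (j * j !)) ⟩
  2 ^ (suc j + 0) * suc j !             ∎
  where open ≤-Reasoning
rising≤ (suc j) (suc k) = begin
  rising (suc j) (suc k)                                          ≡⟨ rising-pascal j k ⟩
  rising (suc j) k + suc j * rising j (suc k)                     ≤⟨ +-mono-≤ (rising≤ (suc j) k) (*-monoʳ-≤ (suc j) (rising≤ j (suc k))) ⟩
  2 ^ (suc j + k) * suc j ! + suc j * (2 ^ (j + suc k) * j !)     ≡⟨ cong (λ x → 2 ^ (suc j + k) * suc j ! + suc j * (2 ^ x * j !)) (+-suc j k) ⟩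
  2 ^ (suc j + k) * suc j ! + suc j * (2 ^ (suc j + k) * j !)     ≡⟨ lem (suc j) (2 ^ (suc j + k)) (j !) ⟩
  2 ^ suc (suc j + k) * suc j !                                   ≡⟨ cong (λ x → 2 ^ x * suc j !) (+-suc (suc j) k) ⟨
  2 ^ (suc j + suc k) * suc j !                                   ∎
  where
  open ≤-Reasoning
  lem : ∀ a p x → p * (a * x) + a * (p * x) ≡ (2 * p) * (a * x)
  lem = solve-∀

^-distribʳ-* : ∀ k m n → (m * n) ^ k ≡ m ^ k * n ^ k
^-distribʳ-* zero    m n = refl
^-distribʳ-* (suc k) m n = trans (cong (m * n *_) (^-distribʳ-* k m n)) (lem m n (m ^ k) (n ^ k))
  where
  lem : ∀ m n x y → m * n * (x * y) ≡ m * x * (n * y)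
  lem = solve-∀

-- The central binomial coefficient `rising k k / k !` is at most `4 ^ k`; this replaces Stirling's
-- formula.
^≤! : ∀ k → k ^ k ≤ 4 ^ k * k !
^≤! k = begin
  k ^ k              ≤⟨ ^≤rising k k ⟩
  rising k k         ≤⟨ rising≤ k k ⟩
  2 ^ (k + k) * k !  ≡⟨ cong (_* k !) (trans (^-distribˡ-+-* 2 k k) (sym (^-distribʳ-* k 2 2))) ⟩
  4 ^ k * k !        ∎
  where open ≤-Reasoning

-- The cube of `^≤!` loses a factor `64 ^ k`. Since 128 is 64 times 2, the hypothesis on `k` makes
-- up for it and leaves a gain of `2 ^ k`.
few-twins : ∀ {n k x f} .{{_ : NonZero n}} → 128 * (n * n) ≤ k * (k * k) →
  x * (k ! * (k ! * k !)) ≤ n ^ k * (n ^ k * f) → x * 2 ^ k ≤ f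
few-twins {n} {k} {x} {f} big few =
  *-cancelʳ-≤ (x * 2 ^ k) f (n ^ k * n ^ k) {{m*n≢0 (n ^ k) (n ^ k) {{m^n≢0 n k}} {{m^n≢0 n k}}}} (begin
    x * 2 ^ k * (n ^ k * n ^ k)    ≡⟨ *-assoc x (2 ^ k) _ ⟩
    x * (2 ^ k * (n ^ k * n ^ k))  ≤⟨ *-monoʳ-≤ x factorial ⟩
    x * (k ! * (k ! * k !))        ≤⟨ few ⟩
    n ^ k * (n ^ k * f)            ≡⟨ trans (sym (*-assoc (n ^ k) (n ^ k) f)) (*-comm _ f) ⟩
    f * (n ^ k * n ^ k)            ∎)
  where
  open ≤-Reasoning
  lem : ∀ p q r a b c → p * a * (q * b * (r * c)) ≡ (p * (q * r)) * (a * (b * c))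
  lem = solve-∀
  factorial : 2 ^ k * (n ^ k * n ^ k) ≤ k ! * (k ! * k !)
  factorial = *-cancelˡ-≤ (64 ^ k) {{m^n≢0 64 k}} (begin
    64 ^ k * (2 ^ k * (n ^ k * n ^ k))                     ≡⟨ *-assoc (64 ^ k) (2 ^ k) _ ⟨
    64 ^ k * 2 ^ k * (n ^ k * n ^ k)                       ≡⟨ cong₂ _*_ (^-distribʳ-* k 64 2) (^-distribʳ-* k n n) ⟨
    128 ^ k * (n * n) ^ k                                  ≡⟨ ^-distribʳ-* k 128 (n * n) ⟨
    (128 * (n * n)) ^ k                                    ≤⟨ ^-monoˡ-≤ k big ⟩
    (k * (k * k)) ^ k                                      ≡⟨ trans (^-distribʳ-* k k (k * k)) (cong (k ^ k *_) (^-distribʳ-* k k k)) ⟩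
    k ^ k * (k ^ k * k ^ k)                                ≤⟨ *-mono-≤ (^≤! k) (*-mono-≤ (^≤! k) (^≤! k)) ⟩
    4 ^ k * k ! * (4 ^ k * k ! * (4 ^ k * k !))            ≡⟨ lem (4 ^ k) (4 ^ k) (4 ^ k) (k !) (k !) (k !) ⟩
    4 ^ k * (4 ^ k * 4 ^ k) * (k ! * (k ! * k !))          ≡⟨ cong (_* (k ! * (k ! * k !))) (cong (4 ^ k *_) (^-distribʳ-* k 4 4)) ⟨
    4 ^ k * 16 ^ k * (k ! * (k ! * k !))                   ≡⟨ cong (_* (k ! * (k ! * k !))) (^-distribʳ-* k 4 16) ⟨
    64 ^ k * (k ! * (k ! * k !))                           ∎)

-- The greedy scan

-- For `S` not full: at most half of the `k` next values are bad, so the average drop is at least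
-- `F / 2`, which is at least `w / (4 J)`.
drift-arith₁ : ∀ J k F s w x → s + k * F ≤ k * w + F * x → 2 * x ≤ k → w ≤ F * (2 * J) →
  k * w + 4 * J * s ≤ 4 * J * (k * w)
drift-arith₁ J k F s w x sum x≤ w≤ = begin
  k * w + 4 * J * s                  ≤⟨ +-monoˡ-≤ _ (*-monoʳ-≤ k w≤) ⟩
  k * (F * (2 * J)) + 4 * J * s      ≡⟨ lem₁ J k F s ⟩
  2 * J * (2 * s + k * F)            ≤⟨ *-monoʳ-≤ (2 * J) (+-cancelʳ-≤ (k * F) _ _ doubled) ⟩
  2 * J * (2 * (k * w))              ≡⟨ lem₂ J (k * w) ⟩
  4 * J * (k * w)                    ∎
  where
  open ≤-Reasoning
  lem₁ : ∀ J k F s → k * (F * (2 * J)) + 4 * J * s ≡ 2 * J * (2 * s + k * F)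
  lem₁ = solve-∀
  lem₂ : ∀ J y → 2 * J * (2 * y) ≡ 4 * J * y
  lem₂ = solve-∀
  lem₃ : ∀ s y → 2 * s + y + y ≡ 2 * (s + y)
  lem₃ = solve-∀
  lem₄ : ∀ y F x → 2 * (y + F * x) ≡ 2 * y + 2 * x * F
  lem₄ = solve-∀
  doubled : 2 * s + k * F + k * F ≤ 2 * (k * w) + k * F
  doubled = begin
    2 * s + k * F + k * F        ≡⟨ lem₃ s (k * F) ⟩
    2 * (s + k * F)              ≤⟨ *-monoʳ-≤ 2 sum ⟩
    2 * (k * w + F * x)          ≡⟨ lem₄ (k * w) F x ⟩
    2 * (k * w) + 2 * x * F      ≤⟨ +-monoʳ-≤ (2 * (k * w)) (*-monoˡ-≤ F x≤) ⟩
    2 * (k * w) + k * F          ∎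

-- For `S` full: at least `J * r` of the `k` next values are hits, each saving `2 * E * J`. The
-- total saving is at least `k * E`, the fraction `1 / (4 J)` of `k * (4 * E * J)`.
drift-arith₂ : ∀ J k E s z r → s + z * (2 * E * J) ≤ k * (4 * E * J) → J * r ≤ z → k ≤ 2 * (J * J * r) →
  k * (4 * E * J) + 4 * J * s ≤ 4 * J * (k * (4 * E * J))
drift-arith₂ J k E s z r sum ≤z k≤ = begin
  k * (4 * E * J) + 4 * J * s                          ≤⟨ +-monoˡ-≤ _ (*-monoˡ-≤ (4 * E * J) k≤) ⟩
  2 * (J * J * r) * (4 * E * J) + 4 * J * s            ≡⟨ lem J r E s ⟩
  4 * J * (s + J * r * (2 * E * J))                    ≤⟨ *-monoʳ-≤ (4 * J) (+-monoʳ-≤ s (*-monoˡ-≤ (2 * E * J) ≤z)) ⟩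
  4 * J * (s + z * (2 * E * J))                        ≤⟨ *-monoʳ-≤ (4 * J) sum ⟩
  4 * J * (k * (4 * E * J))                            ∎
  where
  open ≤-Reasoning
  lem : ∀ J r E s → 2 * (J * J * r) * (4 * E * J) + 4 * J * s ≡ 4 * J * (s + J * r * (2 * E * J))
  lem = solve-∀

allPairs-lookup : ∀ {R : A → A → Set} {xs} → AllPairs R xs → ∀ {i j} → i <ᶠ j →
  R (List.lookup xs i) (List.lookup xs j)
allPairs-lookup (Rx ∷ _)   {zero}  {suc j} _         = All.lookup Rx (∈-lookup j)
allPairs-lookup (_ ∷ Rxs)  {suc i} {suc j} (s≤s i<j) = allPairs-lookup Rxs i<j

-- `w` is the length of a block of values, `r` the threshold for the values a block must still have
-- to come, and `J` the size at which the list of blocks met is full.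
module Greedy (n w r J : ℕ) {{_ : NonZero w}} where

  block : Fin n → ℕ
  block v = toℕ v / w

  occ : ℕ → List (Fin n) → ℕ
  occ b xs = ∑ xs (λ v → ind (block v ≟ b))

  occ-minus-≢ : ∀ {xs v b} → Unique xs → v ∈ xs → block v ≢ b → occ b xs ≡ occ b (xs - v)
  occ-minus-≢ {xs} {v} {b} xs! v∈xs v≢b =
    trans (∑-minus xs! v∈xs _) (cong (_+ occ b (xs - v)) (ind-false (block v ≟ b) v≢b))

  occ-minus : ∀ {xs v} b → Unique xs → v ∈ xs → occ b xs ≤ suc (occ b (xs - v))
  occ-minus {xs} {v} b xs! v∈xs = ≤-trans (≤-reflexive (∑-minus xs! v∈xs _))
    (+-monoˡ-≤ (occ b (xs - v)) (ind≤1 (block v ≟ b)))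

  -- Within a block a value is determined by its remainder modulo `w`.
  occ≤w : ∀ {xs} → Unique xs → ∀ b → occ b xs ≤ w
  occ≤w {xs} xs! b = begin
    occ b xs                                   ≡⟨ length-filter-∑ (λ v → block v ≟ b) xs ⟨
    length (filter (λ v → block v ≟ b) xs)     ≤⟨ length-≤-of-injection (λ v i → toℕ v % w ≡ i) _ (upTo w)
                                                    (Unique.filter⁺ _ xs!)
                                                    (λ _ → _ , ∈-upTo⁺ (m%n<n _ w) , refl) injective ⟩
    length (upTo w)                            ≡⟨ List.length-upTo w ⟩
    w                                          ∎
    where
    open ≤-Reasoning
    injective : ∀ {u v i} → u ∈ filter (λ v → block v ≟ b) xs → v ∈ filter (λ v → block v ≟ b) xs →
                toℕ u % w ≡ i → toℕ v % w ≡ i → u ≡ v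
    injective {u} {v} u∈ v∈ refl eq
      with ∈-filter⁻ (λ v → block v ≟ b) {xs = xs} u∈ | ∈-filter⁻ (λ v → block v ≟ b) {xs = xs} v∈
    ... | _ , refl | _ , blocks = Fin.toℕ-injective
      (trans (m≡m%n+[m/n]*n (toℕ u) w) (trans (sym (cong₂ (λ x y → x + y * w) eq blocks))
        (sym (m≡m%n+[m/n]*n (toℕ v) w))))

  ∑-∈-≤ : ∀ xs U c → (∀ {b} → b ∈ U → occ b xs ≤ c) → ∑ xs (λ v → ind (block v ∈? U)) ≤ length U * c
  ∑-∈-≤ xs [] c occ≤ = ≤-reflexive (trans (∑-const xs 0) (*-zeroʳ (length xs)))
  ∑-∈-≤ xs (b ∷ U) c occ≤ = begin
    ∑ xs (λ v → ind (block v ∈? b ∷ U))                           ≤⟨ ∑-mono xs (λ {v} _ → ind-subadditive (block v ≟ b) (block v ∈? U) (block v ∈? b ∷ U) Any.toSum) ⟩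
    ∑ xs (λ v → ind (block v ≟ b) + ind (block v ∈? U))           ≡⟨ ∑-distrib-+ xs _ _ ⟩
    occ b xs + ∑ xs (λ v → ind (block v ∈? U))                    ≤⟨ +-mono-≤ (occ≤ (here refl)) (∑-∈-≤ xs U c (occ≤ ∘ there)) ⟩
    c + length U * c                                              ∎
    where
    open ≤-Reasoning

  -- Distinct blocks are disjoint, so their occurrences add up without overlap.
  ∑-∈-≥ : ∀ xs S c → Unique S → (∀ {b} → b ∈ S → c ≤ occ b xs) → length S * c ≤ ∑ xs (λ v → ind (block v ∈? S))
  ∑-∈-≥ xs [] c S! ≤occ = z≤n
  ∑-∈-≥ xs (b ∷ S) c (b∉S ∷ S!) ≤occ = begin
    c + length S * c                                              ≤⟨ +-mono-≤ (≤occ (here refl)) (∑-∈-≥ xs S c S! (≤occ ∘ there)) ⟩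
    occ b xs + ∑ xs (λ v → ind (block v ∈? S))                    ≡⟨ ∑-distrib-+ xs _ _ ⟨
    ∑ xs (λ v → ind (block v ≟ b) + ind (block v ∈? S))           ≤⟨ ∑-mono xs (λ {v} _ → ind-superadditive (block v ≟ b) (block v ∈? S) (block v ∈? b ∷ S)
      (λ { (refl , v∈S) → All.lookup b∉S v∈S refl }) Any.fromSum) ⟩
    ∑ xs (λ v → ind (block v ∈? b ∷ S))                           ∎
    where
    open ≤-Reasoning

  -- Block indices lie below `nb`, and a block with at most `r` values to come contributes at most
  -- `r`.
  ∑-poor : ∀ xs nb → n ≤ nb * w → ∑ xs (λ v → ind (occ (block v) xs ≤? r)) ≤ nb * r
  ∑-poor xs nb n≤ = begin
    ∑ xs (λ v → ind (occ (block v) xs ≤? r))   ≤⟨ ∑-mono xs (λ {v} _ → ind-mono (occ (block v) xs ≤? r) (block v ∈? poor)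
      (∈-filter⁺ poor? (∈-upTo⁺ (m<n*o⇒m/o<n {n = nb} (≤-trans (Fin.toℕ<n v) n≤))))) ⟩
    ∑ xs (λ v → ind (block v ∈? poor))         ≤⟨ ∑-∈-≤ xs poor r (λ b∈ → proj₂ (∈-filter⁻ poor? {xs = upTo nb} b∈)) ⟩
    length poor * r                            ≤⟨ *-monoˡ-≤ r (≤-trans (List.length-filter poor? (upTo nb)) (≤-reflexive (List.length-upTo nb))) ⟩
    nb * r                                     ∎
    where
    open ≤-Reasoning
    poor? : Decidable (λ b → occ b xs ≤ r)
    poor? b = occ b xs ≤? r
    poor = filter poor? (upTo nb)

  -- U holds the blocks used by the pairs already found, S the blocks met since the last pair was
  -- found, xs the values still to come. Only blocks with more than r values to come enter S.
  data Move (U S : List ℕ) (xs : List (Fin n)) (v : Fin n) : Set where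
    hit  : block v ∈ S → Move U S xs v
    grow : block v ∉ S → length S < J → block v ∉ U → r < occ (block v) xs → Move U S xs v
    skip : block v ∉ S → (J ≤ length S ⊎ block v ∈ U ⊎ occ (block v) xs ≤ r) → Move U S xs v

  move : ∀ U S xs v → Move U S xs v
  move U S xs v with block v ∈? S
  ... | yes ∈S = hit ∈S
  ... | no ∉S with length S <? J | block v ∈? U | occ (block v) xs ≤? r
  ...   | no ≮J | _      | _     = skip ∉S (inj₁ (≮⇒≥ ≮J))
  ...   | yes _ | yes ∈U | _     = skip ∉S (inj₂ (inj₁ ∈U))
  ...   | yes _ | no _   | yes ≤r = skip ∉S (inj₂ (inj₂ ≤r))
  ...   | yes <J | no ∉U | no ≰r = grow ∉S <J ∉U (≰⇒> ≰r)

  -- Equals 1 if at most `L` steps do not complete the `e` pairs still wanted, and 0 otherwise; a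
  -- number rather than a predicate, so that its sum counts failing permutations.
  fails : ℕ → ℕ → List ℕ → List ℕ → List (Fin n) → Vec (Fin n) k → ℕ
  fails L       zero    U S xs vs       = 0
  fails zero    (suc e) U S xs vs       = 1
  fails (suc L) (suc e) U S xs []       = 1
  fails (suc L) (suc e) U S xs (v ∷ vs) with move U S xs v
  -- Emptying `S` makes the next pair start after this one has ended; recording the block in `U`
  -- keeps the blocks of the pairs distinct.
  ... | hit _        = fails L e (block v ∷ U) [] (xs - v) vs
  ... | grow _ _ _ _ = fails L (suc e) U (block v ∷ S) (xs - v) vs
  ... | skip _ _     = fails L (suc e) U S (xs - v) vs

  -- While `s` is at most `J`, the second factor lies between `J` and `2 * J`. The reset of `s`
  -- after a hit thus at most doubles it, which the lost factor 4 outweighs.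
  weight : ℕ → ℕ → ℕ
  weight e s = 4 ^ e * (2 * J ∸ s)

  weight-next : ∀ {U S xs v} → ℕ → Move U S xs v → ℕ
  weight-next         e (hit _)        = weight e 0
  weight-next {S = S} e (grow _ _ _ _) = weight (suc e) (suc (length S))
  weight-next {S = S} e (skip _ _)     = weight (suc e) (length S)

  -- `s₀` pairs are wanted in all, `nb` bounds the number of blocks, and `h` values stay unread.
  -- `room` makes at most half of the next values useless while `S` is not full; `large` gives a hit
  -- probability at least `1 / (2 J)` once it is full.
  module Bound (s₀ nb h D′ : ℕ) (D≡ : suc D′ ≡ 4 * J) (blocks : n ≤ nb * w)
               (room : 2 * (s₀ * w + nb * r) ≤ h) (large : n ≤ 2 * (J * J * r)) where

    double∸ : 2 * J ∸ J ≡ J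
    double∸ = trans (cong (_∸ J) (cong (J +_) (+-identityʳ J))) (m+n∸n≡m J J)

    J≤2J∸ : ∀ {s} → s ≤ J → J ≤ 2 * J ∸ s
    J≤2J∸ s≤J = ≤-trans (≤-reflexive (sym double∸)) (∸-monoʳ-≤ (2 * J) s≤J)

    J<2J∸ : ∀ {s} → s < J → J < 2 * J ∸ s
    J<2J∸ s<J = ≤-trans (≤-reflexive (cong suc (sym double∸)))
                        (∸-monoʳ-< s<J (m≤m+n J _))

    -- Growth lowers the weight by exactly `4 ^ suc e`, and a hit by at least as much. A skip can
    -- only come from a used or a poor block, and then the indicators on the right pay for it.
    drop-below : ∀ {U S xs v} e → length S < J → (m : Move U S xs v) →
      weight-next e m + 4 ^ suc e ≤
      weight (suc e) (length S) + 4 ^ suc e * (ind (block v ∈? U) + ind (occ (block v) xs ≤? r))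
    drop-below {S = S} e <J (hit _) = ≤-trans (begin
      4 ^ e * (2 * J) + 4 * 4 ^ e       ≤⟨ m≤m+n _ (2 * J * 4 ^ e) ⟩
      4 ^ e * (2 * J) + 4 * 4 ^ e + 2 * J * 4 ^ e ≡⟨ lem (4 ^ e) J ⟩
      4 * 4 ^ e * suc J                 ≤⟨ *-monoʳ-≤ (4 * 4 ^ e) (J<2J∸ <J) ⟩
      4 * 4 ^ e * (2 * J ∸ length S)    ∎) (m≤m+n _ _)
      where
      open ≤-Reasoning
      lem : ∀ E J → E * (2 * J) + 4 * E + 2 * J * E ≡ 4 * E * suc J
      lem = solve-∀
    drop-below {S = S} e <J (grow _ _ _ _) = ≤-trans (≤-reflexive (begin
      F * (2 * J ∸ suc (length S)) + F          ≡⟨ trans (+-comm _ F) (sym (*-suc F _)) ⟩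
      F * suc (2 * J ∸ suc (length S))          ≡⟨ cong (F *_) (suc-∸-suc (≤-trans <J (m≤m+n J _))) ⟩
      F * (2 * J ∸ length S)                    ∎)) (m≤m+n _ _)
      where
      open ≡-Reasoning
      F = 4 ^ suc e
      suc-∸-suc : ∀ {a b} → b < a → suc (a ∸ suc b) ≡ a ∸ b
      suc-∸-suc {suc a} {b} (s≤s b≤a) = sym (+-∸-assoc 1 b≤a)
    drop-below e <J (skip _ (inj₁ J≤)) = contradiction <J (≤⇒≯ J≤)
    drop-below {U} {S} {xs} {v} e <J (skip _ (inj₂ (inj₁ v∈U))) =
      +-monoʳ-≤ (weight (suc e) (length S)) (m≤m*n (4 ^ suc e) _ {{>-nonZero
        (≤-trans (ind-true (block v ∈? U) v∈U) (m≤m+n _ _))}})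
    drop-below {U} {S} {xs} {v} e <J (skip _ (inj₂ (inj₂ ≤r))) =
      +-monoʳ-≤ (weight (suc e) (length S)) (m≤m*n (4 ^ suc e) _ {{>-nonZero
        (≤-trans (ind-true (occ (block v) xs ≤? r) ≤r) (m≤n+m _ (ind (block v ∈? U))))}})

    weight-full : ∀ e {s} → s ≡ J → weight (suc e) s ≡ 4 * 4 ^ e * J
    weight-full e refl = cong (4 * 4 ^ e *_) double∸

    -- At full size a hit leaves half of the weight, growth is impossible, and a skip changes
    -- nothing.
    drop-full : ∀ {U S xs v} e → length S ≡ J → (m : Move U S xs v) →
      weight-next e m + ind (block v ∈? S) * (2 * 4 ^ e * J) ≤ 4 * 4 ^ e * J
    drop-full {S = S} {v = v} e eq (hit _) = begin
      4 ^ e * (2 * J) + ind (block v ∈? S) * (2 * 4 ^ e * J)   ≤⟨ +-monoʳ-≤ (4 ^ e * (2 * J)) (*-monoˡ-≤ (2 * 4 ^ e * J) (ind≤1 (block v ∈? S))) ⟩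
      4 ^ e * (2 * J) + 1 * (2 * 4 ^ e * J)                    ≡⟨ lem (4 ^ e) J ⟩
      4 * 4 ^ e * J                                            ∎
      where
      open ≤-Reasoning
      lem : ∀ E J → E * (2 * J) + 1 * (2 * E * J) ≡ 4 * E * J
      lem = solve-∀
    drop-full e eq (grow _ <J _ _) = contradiction eq (<⇒≢ <J)
    drop-full {S = S} {v = v} e eq (skip ∉S _)
      rewrite ind-false (block v ∈? S) ∉S | +-identityʳ (weight (suc e) (length S)) = ≤-reflexive (weight-full e eq)

    -- `rich` is one weaker than the entry condition of `grow`, because the value that brings a
    -- block into `S` itself leaves `xs`. It persists, since any further value of that block is a
    -- hit and empties `S`.
    record Invariant (k L e : ℕ) (U S : List ℕ) (xs : List (Fin n)) : Set where
      field
        xs!   : Unique xs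
        len   : length xs ≡ k
        k≤n   : k ≤ n
        time  : L + h ≤ k
        used  : length U + e ≤ s₀
        S!    : Unique S
        S≤J   : length S ≤ J
        rich  : ∀ {b} → b ∈ S → r ≤ occ b xs

    -- One step of a supermartingale with denominators cleared: the mean weight shrinks by the
    -- factor `1 - 1 / (4 J)`. Adding `k * W` to both sides avoids subtraction.
    drift : ∀ {k L e U S xs} → Invariant k L (suc e) U S xs →
      suc D′ * ∑ xs (λ v → weight-next e (move U S xs v)) ≤ k * (D′ * weight (suc e) (length S))
    drift {k} {L} {e} {U} {S} {xs} inv = +-cancelˡ-≤ (k * W) _ _ (begin
      k * W + suc D′ * Σ′        ≡⟨ cong (λ d → k * W + d * Σ′) D≡ ⟩
      k * W + 4 * J * Σ′         ≤⟨ by-size (m≤n⇒m<n∨m≡n S≤J) ⟩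
      4 * J * (k * W)            ≡⟨ cong (_* (k * W)) D≡ ⟨
      k * W + D′ * (k * W)       ≡⟨ cong (k * W +_) (lem D′ k W) ⟩
      k * W + k * (D′ * W)       ∎)
      where
      open Invariant inv
      open ≤-Reasoning
      W  = weight (suc e) (length S)
      Σ′ = ∑ xs (λ v → weight-next e (move U S xs v))
      lem : ∀ d k W → d * (k * W) ≡ k * (d * W)
      lem = solve-∀
      by-size : length S < J ⊎ length S ≡ J → k * W + 4 * J * Σ′ ≤ 4 * J * (k * W)
      by-size (inj₁ <J) = drift-arith₁ J k F Σ′ W X (begin
          Σ′ + k * F                                  ≡⟨ cong (λ l → Σ′ + l * F) len ⟨
          Σ′ + length xs * F                          ≡⟨ cong (Σ′ +_) (∑-const xs F) ⟨
          Σ′ + ∑ xs (λ _ → F)                         ≡⟨ ∑-distrib-+ xs _ _ ⟨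
          ∑ xs (λ v → weight-next e (move U S xs v) + F)
                                                      ≤⟨ ∑-mono xs (λ {v} _ → drop-below e <J (move U S xs v)) ⟩
          ∑ xs (λ v → W + F * bad v)                  ≡⟨ ∑-distrib-+ xs _ _ ⟩
          ∑ xs (λ _ → W) + ∑ xs (λ v → F * bad v)     ≡⟨ cong₂ _+_ (trans (∑-const xs W) (cong (_* W) len))
                                                           (trans (∑-cong xs (λ v → *-comm F (bad v)))
                                                             (trans (∑-distribʳ-* xs bad F) (*-comm X F))) ⟩
          k * W + F * X                               ∎)
          (begin
          -- Bad values lie in used blocks, of `w` values each, or in poor blocks.
          2 * X                                       ≡⟨ cong (2 *_) (∑-distrib-+ xs _ _) ⟩
          2 * (∑ xs (λ v → ind (block v ∈? U)) + ∑ xs (λ v → ind (occ (block v) xs ≤? r)))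
                                                      ≤⟨ *-monoʳ-≤ 2 (+-mono-≤
                                                           (∑-∈-≤ xs U w (λ {b} _ → occ≤w xs! b))
                                                           (∑-poor xs nb blocks)) ⟩
          2 * (length U * w + nb * r)                 ≤⟨ *-monoʳ-≤ 2 (+-monoˡ-≤ (nb * r) (*-monoˡ-≤ w (≤-trans (m≤m+n (length U) (suc e)) used))) ⟩
          2 * (s₀ * w + nb * r)                       ≤⟨ room ⟩
          h                                           ≤⟨ ≤-trans (m≤n+m h L) time ⟩
          k                                           ∎)
          (*-monoʳ-≤ F (m∸n≤m (2 * J) (length S)))
        where
        F = 4 ^ suc e
        bad : Fin n → ℕ
        bad v = ind (block v ∈? U) + ind (occ (block v) xs ≤? r)
        X = ∑ xs bad
      by-size (inj₂ ≡J) = subst (λ W → k * W + 4 * J * Σ′ ≤ 4 * J * (k * W)) (sym (weight-full e ≡J))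
        (drift-arith₂ J k (4 ^ e) Σ′ Z r (begin
          Σ′ + Z * G                                  ≡⟨ cong (Σ′ +_) (∑-distribʳ-* xs _ G) ⟨
          Σ′ + ∑ xs (λ v → ind (block v ∈? S) * G)    ≡⟨ ∑-distrib-+ xs _ _ ⟨
          ∑ xs (λ v → weight-next e (move U S xs v) + ind (block v ∈? S) * G)
                                                      ≤⟨ ∑-mono xs (λ {v} _ → drop-full e ≡J (move U S xs v)) ⟩
          ∑ xs (λ _ → 4 * 4 ^ e * J)                  ≡⟨ trans (∑-const xs _) (cong (_* (4 * 4 ^ e * J)) len) ⟩
          k * (4 * 4 ^ e * J)                         ∎)
          -- Each of the `J` distinct blocks in `S` still has `r` values to come, and all of these
          -- are hits.
          (subst (λ s → s * r ≤ Z) ≡J (∑-∈-≥ xs S r S! rich))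
          (≤-trans k≤n large))
        where
        G = 2 * 4 ^ e * J
        Z = ∑ xs (λ v → ind (block v ∈? S))

    module _ {k L e U S xs v} (inv : Invariant (suc k) (suc L) (suc e) U S xs) (v∈xs : v ∈ xs) where
      open Invariant inv

      private
        len′ : length (xs - v) ≡ k
        len′ = suc-injective (trans (sym (length-minus xs! v∈xs)) len)

        rich′ : block v ∉ S → ∀ {b} → b ∈ S → r ≤ occ b (xs - v)
        rich′ ∉S b∈S = ≤-trans (rich b∈S) (≤-reflexive (occ-minus-≢ xs! v∈xs (λ { refl → ∉S b∈S })))

      invariant-hit : Invariant k L e (block v ∷ U) [] (xs - v)
      invariant-hit = record
        { xs! = minus-unique xs! ; len = len′ ; k≤n = <⇒≤ k≤n ; time = ≤-pred time
        ; used = ≤-trans (≤-reflexive (sym (+-suc (length U) e))) used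
        ; S! = [] ; S≤J = z≤n ; rich = λ () }

      invariant-grow : block v ∉ S → length S < J → r < occ (block v) xs →
        Invariant k L (suc e) U (block v ∷ S) (xs - v)
      invariant-grow ∉S <J >r = record
        { xs! = minus-unique xs! ; len = len′ ; k≤n = <⇒≤ k≤n ; time = ≤-pred time ; used = used
        ; S! = All.tabulate (λ { b∈S refl → ∉S b∈S }) ∷ S! ; S≤J = <J
        ; rich = λ { (here refl) → ≤-pred (≤-trans >r (occ-minus (block v) xs! v∈xs))
                   ; (there b∈S) → rich′ ∉S b∈S } }

      invariant-skip : block v ∉ S → Invariant k L (suc e) U S (xs - v)
      invariant-skip ∉S = record
        { xs! = minus-unique xs! ; len = len′ ; k≤n = <⇒≤ k≤n ; time = ≤-pred time ; used = used
        ; S! = S! ; S≤J = S≤J ; rich = rich′ ∉S }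

    -- Markov's inequality for the weight: `drift` bounds its mean after `L` steps, and a scan that
    -- runs out of time has weight at least `J`.
    count-fails : ∀ L {k e U S xs} → Invariant k L e U S xs →
      ∑ (arrangements k xs) (fails L e U S xs) * (suc D′ ^ L * J) ≤ k ! * (D′ ^ L * weight e (length S))
    count-fails L {k} {zero} {U} {S} {xs} inv
      rewrite trans (∑-const (arrangements k xs) 0) (*-zeroʳ (length (arrangements k xs))) = z≤n
    -- Every ordering fails here, and since `length S ≤ J` the weight is at least `J`.
    count-fails zero {k} {suc e} {U} {S} {xs} inv = *-mono-≤
      (≤-reflexive (trans (sym (length-∑ (arrangements k xs))) (length-arrangements k xs xs! len)))
      (*-monoʳ-≤ 1 (≤-trans (J≤2J∸ S≤J) (m≤n*m _ (4 ^ suc e) {{m^n≢0 4 (suc e)}})))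
      where open Invariant inv
    count-fails (suc L) {zero} {suc e} inv with Invariant.time inv
    ... | ()
    count-fails (suc L) {suc k} {suc e} {U} {S} {xs} inv = begin
      ∑ (arrangements (suc k) xs) (fails (suc L) (suc e) U S xs) * (D * D ^ L * J)
                                                         ≡⟨ cong (_* (D * D ^ L * J)) (∑-arrangements k xs _) ⟩
      ∑ xs F * (D * D ^ L * J)                           ≡⟨ lem₁ (∑ xs F) D (D ^ L) J ⟩
      D * (∑ xs F * (D ^ L * J))                         ≡⟨ cong (D *_) (∑-distribʳ-* xs F (D ^ L * J)) ⟨
      D * ∑ xs (λ v → F v * (D ^ L * J))                 ≤⟨ *-monoʳ-≤ D (∑-mono xs (λ v∈ → step v∈)) ⟩
      D * ∑ xs (λ v → W v * (k ! * D′ ^ L))              ≡⟨ cong (D *_) (∑-distribʳ-* xs W (k ! * D′ ^ L)) ⟩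
      D * (∑ xs W * (k ! * D′ ^ L))                      ≡⟨ *-assoc D (∑ xs W) _ ⟨
      D * ∑ xs W * (k ! * D′ ^ L)                        ≤⟨ *-monoˡ-≤ (k ! * D′ ^ L) (drift inv) ⟩
      suc k * (D′ * weight (suc e) (length S)) * (k ! * D′ ^ L)
                                                         ≡⟨ lem₂ (suc k) D′ (weight (suc e) (length S)) (k !) (D′ ^ L) ⟩
      suc k * k ! * (D′ * D′ ^ L * weight (suc e) (length S)) ∎
      where
      open ≤-Reasoning
      D = suc D′
      F W : Fin n → ℕ
      F v = ∑ (arrangements k (xs - v)) (λ vs → fails (suc L) (suc e) U S xs (v ∷ vs))
      W v = weight-next e (move U S xs v)
      lem₁ : ∀ f d p j → f * (d * p * j) ≡ d * (f * (p * j))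
      lem₁ = solve-∀
      lem₂ : ∀ k d w f p → k * (d * w) * (f * p) ≡ k * f * (d * p * w)
      lem₂ = solve-∀
      lem₃ : ∀ f p w → f * (p * w) ≡ w * (f * p)
      lem₃ = solve-∀
      step : ∀ {v} → v ∈ xs → F v * (D ^ L * J) ≤ W v * (k ! * D′ ^ L)
      step {v} v∈ with move U S xs v
      ... | hit _           = ≤-trans (count-fails L (invariant-hit inv v∈)) (≤-reflexive (lem₃ (k !) (D′ ^ L) _))
      ... | grow ∉S <J _ >r = ≤-trans (count-fails L (invariant-grow inv v∈ ∉S <J >r)) (≤-reflexive (lem₃ (k !) (D′ ^ L) _))
      ... | skip ∉S _       = ≤-trans (count-fails L (invariant-skip inv v∈ ∉S)) (≤-reflexive (lem₃ (k !) (D′ ^ L) _))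

    few-fails : ∀ {T} → .{{_ : NonZero J}} → T + h ≤ n →
      ∑ (perms n) (fails T s₀ [] [] (allFin n)) * suc D′ ^ T ≤ n ! * (D′ ^ T * (4 ^ s₀ * 2))
    few-fails {T} T+h≤n = *-cancelʳ-≤ _ _ J (begin
      f * suc D′ ^ T * J                  ≡⟨ *-assoc f (suc D′ ^ T) J ⟩
      f * (suc D′ ^ T * J)                ≤⟨ count-fails T initial ⟩
      n ! * (D′ ^ T * (4 ^ s₀ * (2 * J))) ≡⟨ lem (n !) (D′ ^ T) (4 ^ s₀) J ⟩
      n ! * (D′ ^ T * (4 ^ s₀ * 2)) * J   ∎)
      where
      open ≤-Reasoning
      f = ∑ (perms n) (fails T s₀ [] [] (allFin n))
      lem : ∀ a b c j → a * (b * (c * (2 * j))) ≡ a * (b * (c * 2)) * j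
      lem = solve-∀
      initial : Invariant n T s₀ [] [] (allFin n)
      initial = record
        { xs! = Unique.allFin⁺ n ; len = List.length-tabulate (λ i → i) ; k≤n = ≤-refl ; time = T+h≤n
        ; used = ≤-refl ; S! = [] ; S≤J = z≤n ; rich = λ () }

  -- Twins from a successful scan

  record Paired (π : Fin n → Fin n) (lo : ℕ) (U : List ℕ) (pq : Fin n × Fin n) : Set where
    constructor paired
    p = proj₁ pq
    q = proj₂ pq
    field
      late  : lo ≤ toℕ p
      p<q   : p <ᶠ q
      same  : block (π p) ≡ block (π q)
      fresh : block (π p) ∉ U

  Separated : (Fin n → Fin n) → Fin n × Fin n → Fin n × Fin n → Set
  Separated π (p , q) (p′ , q′) = q <ᶠ p′ × block (π p) ≢ block (π p′)

  -- A position already read that can serve as the first entry of a pair in block `b`.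
  Pending : (Fin n → Fin n) → ℕ → (Fin k → Fin n) → ℕ → Set
  Pending π lo pos b = ∃ λ p → lo ≤ toℕ p × (∀ a → p <ᶠ pos a) × block (π p) ≡ b

  -- Replays the scan on the entries at the positions `pos`. Each block in `S` keeps a pending
  -- position; a hit pairs it with the current one and moves `lo` just past it, which separates all
  -- later pairs from this one.
  find-pairs : (π : Fin n → Fin n) → ∀ L e U S xs (vs : Vec (Fin n) k) (pos : Fin k → Fin n) lo →
    Increasing pos → (∀ a → lookup vs a ≡ π (pos a)) → (∀ a → lo ≤ toℕ (pos a)) →
    (∀ {b} → b ∈ S → b ∉ U × Pending π lo pos b) →
    fails L e U S xs vs ≡ 0 →
    ∃ λ ps → length ps ≡ e × All (Paired π lo U) ps × AllPairs (Separated π) ps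
  find-pairs π L zero U S xs vs pos lo incr vals late pending ok = [] , refl , [] , []
  find-pairs π (suc L) (suc e) U S xs (v ∷ vs) pos lo incr vals late pending ok with move U S xs v
  ... | hit v∈S with pending v∈S
  ...   | v∉U , p , lo≤p , p<pos , eq
    with find-pairs π L e (block v ∷ U) [] (xs - v) vs (pos ∘ suc) (suc (toℕ (pos zero)))
           (λ a b a<b → incr (suc a) (suc b) (s≤s a<b)) (vals ∘ suc)
           (λ a → incr zero (suc a) (s≤s z≤n)) (λ ()) ok
  ...   | ps , len , good , sep =
    (p , pos zero) ∷ ps , cong suc len ,
    paired lo≤p (p<pos zero) (trans eq (cong block (vals zero))) (subst (_∉ U) (sym eq) v∉U) ∷
      All.map (λ (paired late′ lt same fresh) →
        paired (≤-trans (late zero) (<⇒≤ late′)) lt same (fresh ∘ there)) good ,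
    All.map (λ (paired late′ lt same fresh) → late′ , λ eq′ → fresh (here (trans (sym eq′) eq))) good ∷ sep
  find-pairs π (suc L) (suc e) U S xs (v ∷ vs) pos lo incr vals late pending ok | grow ∉S <J ∉U >r =
    find-pairs π L (suc e) U (block v ∷ S) (xs - v) vs (pos ∘ suc) lo
      (λ a b a<b → incr (suc a) (suc b) (s≤s a<b)) (vals ∘ suc) (late ∘ suc)
      (λ { (here refl) → ∉U , pos zero , late zero , (λ a → incr zero (suc a) (s≤s z≤n)) , cong block (sym (vals zero))
         ; (there b∈S) → let b∉U , p , lo≤p , p<pos , eq = pending b∈S in b∉U , p , lo≤p , p<pos ∘ suc , eq }) ok
  find-pairs π (suc L) (suc e) U S xs (v ∷ vs) pos lo incr vals late pending ok | skip ∉S _ =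
    find-pairs π L (suc e) U S (xs - v) vs (pos ∘ suc) lo
      (λ a b a<b → incr (suc a) (suc b) (s≤s a<b)) (vals ∘ suc) (late ∘ suc)
      (λ b∈S → let b∉U , p , lo≤p , p<pos , eq = pending b∈S in b∉U , p , lo≤p , p<pos ∘ suc , eq) ok

  <-of-blocks : ∀ {u v} → block u ≢ block v → (u <ᶠ v) ⇔ (block u < block v)
  <-of-blocks {u} {v} neq = mk⇔
    (λ u<v → ≤∧≢⇒< (/-monoˡ-≤ w (<⇒≤ u<v)) neq)
    (λ lt → ≰⇒> (λ v≤u → ≤⇒≯ (/-monoˡ-≤ w v≤u) lt))

  -- The pairs occupy successive intervals of positions, hence the increasing and disjoint indices.
  -- Both value sequences are ordered as the blocks of the pairs, which are distinct.
  pairs⇒twins : (π : Vec (Fin n) n) {lo : ℕ} {U : List ℕ} (ps : List (Fin n × Fin n)) →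
    All (Paired (lookup π) lo U) ps → AllPairs (Separated (lookup π)) ps → Twins π (length ps)
  pairs⇒twins π {lo} {U} ps good sep = record
    { idx₁ = p ; idx₂ = q
    ; incr₁ = λ a b a<b → <-trans (Paired.p<q (at a)) (proj₁ (sep-at a<b))
    ; incr₂ = λ a b a<b → <-trans (proj₁ (sep-at a<b)) (Paired.p<q (at b))
    ; disjoint = disjoint
    ; similar = similar
    }
    where
    p q : Fin (length ps) → Fin n
    p a = proj₁ (List.lookup ps a)
    q a = proj₂ (List.lookup ps a)
    at : ∀ a → Paired (lookup π) lo U (List.lookup ps a)
    at a = All.lookup good (∈-lookup a)
    sep-at : ∀ {a b} → a <ᶠ b → Separated (lookup π) (List.lookup ps a) (List.lookup ps b)
    sep-at = allPairs-lookup sep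
    disjoint : ∀ a b → p a ≢ q b
    disjoint a b with Fin.<-cmp a b
    ... | tri< a<b _ _ = λ eq → Fin.<-irrefl eq
      (<-trans (Paired.p<q (at a)) (<-trans (proj₁ (sep-at a<b)) (Paired.p<q (at b))))
    ... | tri≈ _ refl _ = λ eq → Fin.<-irrefl eq (Paired.p<q (at a))
    ... | tri> _ _ b<a = λ eq → Fin.<-irrefl (sym eq) (proj₁ (sep-at b<a))
    similar : ∀ a b → a <ᶠ b → (lookup π (p a) <ᶠ lookup π (p b)) ⇔ (lookup π (q a) <ᶠ lookup π (q b))
    similar a b a<b = mk⇔
      (λ lt → Equivalence.from (<-of-blocks neq′) (subst₂ _<_ eqa eqb (Equivalence.to (<-of-blocks neq) lt)))
      (λ lt → Equivalence.from (<-of-blocks neq) (subst₂ _<_ (sym eqa) (sym eqb) (Equivalence.to (<-of-blocks neq′) lt)))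
      where
      neq = proj₂ (sep-at a<b)
      eqa = Paired.same (at a)
      eqb = Paired.same (at b)
      neq′ = subst₂ _≢_ eqa eqb neq

  ¬fails⇒twins : ∀ T s₀ (π : Vec (Fin n) n) → fails T s₀ [] [] (allFin n) π ≡ 0 → Twins π s₀
  ¬fails⇒twins T s₀ π ok
    with find-pairs (lookup π) T s₀ [] [] (allFin n) π (λ i → i) 0 (λ a b a<b → a<b) (λ a → refl)
           (λ a → z≤n) (λ ()) ok
  ... | ps , refl , good , sep = pairs⇒twins π ps good sep

-- Choice of the parameters

-- The first two terms of the binomial expansion: Bernoulli's inequality without division.
bernoulli : ∀ d m → d ^ suc m + suc m * d ^ m ≤ suc d ^ suc m
bernoulli d zero    = ≤-reflexive (lem d)
  where
  lem : ∀ d → d * 1 + 1 ≡ suc d * 1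
  lem = solve-∀
bernoulli d (suc m) = begin
  d * d ^ suc m + (d ^ suc m + suc m * d ^ suc m)                   ≤⟨ m≤m+n _ (suc m * d ^ m) ⟩
  d * d ^ suc m + (d ^ suc m + suc m * d ^ suc m) + suc m * d ^ m   ≡⟨ lem d (d ^ m) (suc m) ⟩
  suc d * (d ^ suc m + suc m * d ^ m)                               ≤⟨ *-monoʳ-≤ (suc d) (bernoulli d m) ⟩
  suc d * suc d ^ suc m                                             ∎
  where
  open ≤-Reasoning
  lem : ∀ d p k → d * (d * p) + (d * p + k * (d * p)) + k * p ≡ suc d * (d * p + k * p)
  lem = solve-∀

-- The second Bernoulli term is already at least the first, so `d + 1` factors `d / (d + 1)`
-- multiply to at most one half.
2*d^[1+d]≤ : ∀ d → 2 * d ^ suc d ≤ suc d ^ suc d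
2*d^[1+d]≤ d = begin
  2 * d ^ suc d                  ≡⟨ cong (d ^ suc d +_) (+-identityʳ _) ⟩
  d ^ suc d + d * d ^ d          ≤⟨ +-monoʳ-≤ (d ^ suc d) (*-monoˡ-≤ (d ^ d) (n≤1+n d)) ⟩
  d ^ suc d + suc d * d ^ d      ≤⟨ bernoulli d d ⟩
  suc d ^ suc d                  ∎
  where open ≤-Reasoning

2^y*d^≤ : ∀ d y → 2 ^ y * d ^ (suc d * y) ≤ suc d ^ (suc d * y)
2^y*d^≤ d y = begin
  2 ^ y * d ^ (suc d * y)      ≡⟨ cong (2 ^ y *_) (^-*-assoc d (suc d) y) ⟨
  2 ^ y * (d ^ suc d) ^ y      ≡⟨ ^-distribʳ-* y 2 (d ^ suc d) ⟨
  (2 * d ^ suc d) ^ y          ≤⟨ ^-monoˡ-≤ y (2*d^[1+d]≤ d) ⟩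
  (suc d ^ suc d) ^ y          ≡⟨ ^-*-assoc (suc d) (suc d) y ⟩
  suc d ^ (suc d * y)          ∎
  where open ≤-Reasoning

n≤2^n : ∀ n → n ≤ 2 ^ n
n≤2^n zero    = z≤n
n≤2^n (suc n) = begin
  suc n              ≤⟨ +-mono-≤ (m^n>0 2 n) (n≤2^n n) ⟩
  2 ^ n + 2 ^ n      ≡⟨ cong (2 ^ n +_) (+-identityʳ (2 ^ n)) ⟨
  2 ^ suc n          ∎
  where open ≤-Reasoning

-- A downward search from `m`, used to extract integer cube roots.
bracket : (f : ℕ → ℕ) → ∀ {x} → f 0 ≤ x → ∀ m → x < f m → ∃ λ q → f q ≤ x × x < f (suc q)
bracket f f0≤x zero    x<f = contradiction f0≤x (<⇒≱ x<f)
bracket f {x} f0≤x (suc m) x<f with f m ≤? x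
... | yes fm≤x = m , fm≤x , x<f
... | no fm≰x  = bracket f f0≤x m (≰⇒> fm≰x)

cube : ℕ → ℕ
cube x = x * (x * x)

cube-mono : ∀ x y → x ≤ y → cube x ≤ cube y
cube-mono x y x≤y = *-mono-≤ x≤y (*-mono-≤ x≤y x≤y)

x≤cube : ∀ x → x ≤ cube x
x≤cube zero      = z≤n
x≤cube x@(suc _) = m≤m*n x (x * x)

cube≡^3 : ∀ x → cube x ≡ x ^ 3
cube≡^3 x = cong (λ y → x * (x * y)) (sym (*-identityʳ x))

-- Here `b` lies between 1/32 and 1/16 of the cube root of `n`. Blocks have length `8 b`, the
-- threshold is `b`, up to `128 b` blocks are kept, and `b * b` pairs are wanted.
module Scan (n b : ℕ) (b>0 : 0 < b) (lower : cube b * 4096 ≤ n) (upper : n ≤ cube b * 32768) where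

  private instance
    b≢0 : NonZero b
    b≢0 = >-nonZero b>0
    w≢0 : NonZero (b * 8)
    w≢0 = m*n≢0 b 8
    J≢0 : NonZero (b * 128)
    J≢0 = m*n≢0 b 128

  open Greedy n (b * 8) b (b * 128)

  -- With D = 4J steps per halving, T = D y steps shrink the weight by 2^y = 4^(2b²), which beats
  -- the initial weight 4^(b²) 2J.
  D′ y T nb : ℕ
  D′ = pred (4 * (b * 128))
  y  = 4 * (b * b)
  T  = suc D′ * y
  nb = suc (n / (b * 8))

  D≡ : suc D′ ≡ 4 * (b * 128)
  D≡ = suc-pred (4 * (b * 128)) {{m*n≢0 4 (b * 128)}}

  T≡ : T ≡ cube b * 2048
  T≡ = trans (cong (_* y) D≡) (lem b)
    where
    lem : ∀ b → 4 * (b * 128) * (4 * (b * b)) ≡ b * (b * b) * 2048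
    lem = solve-∀

  T≤n : T ≤ n
  T≤n = ≤-trans (≤-reflexive T≡) (≤-trans (*-monoʳ-≤ (cube b) (m≤m+n 2048 2048)) lower)

  -- The factor 128 in `J` is chosen because `2 * 128 * 128` is the constant 32768 of `upper`.
  large : n ≤ 2 * (b * 128 * (b * 128) * b)
  large = ≤-trans upper (≤-reflexive (lem b))
    where
    lem : ∀ b → b * (b * b) * 32768 ≡ 2 * (b * 128 * (b * 128) * b)
    lem = solve-∀

  blocks : n ≤ nb * (b * 8)
  blocks = ≤-trans (≤-reflexive (m≡m%n+[m/n]*n n (b * 8)))
                   (+-monoˡ-≤ (n / (b * 8) * (b * 8)) (<⇒≤ (m%n<n n (b * 8))))

  -- After multiplication by 8, poor blocks take about `2 * n` of `8 * n`. By `lower` the other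
  -- `6 * n` is at least `24576 * cube b`, while used blocks, scan time and rounding need only 16528
  -- cubes; 8048 is the difference.
  room : 2 * (b * b * (b * 8) + nb * b) ≤ n ∸ T
  room = m+n≤o⇒m≤o∸n _ (*-cancelˡ-≤ 8 (begin
    8 * (2 * (b * b * (b * 8) + nb * b) + T)            ≡⟨ cong (λ t → 8 * (2 * (b * b * (b * 8) + nb * b) + t)) T≡ ⟩
    8 * (2 * (b * b * (b * 8) + nb * b) + cube b * 2048)
                                                        ≡⟨ lem₁ b (n / (b * 8)) ⟩
    cube b * 16512 + 16 * b + 2 * (n / (b * 8) * (b * 8))
                                                        ≤⟨ +-mono-≤ (+-monoʳ-≤ (cube b * 16512) (*-monoʳ-≤ 16 (x≤cube b)))
                                                                    (*-monoʳ-≤ 2 (m/n*n≤m n (b * 8))) ⟩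
    cube b * 16512 + 16 * cube b + 2 * n                ≤⟨ +-monoˡ-≤ (2 * n) (m≤m+n (cube b * 16512 + 16 * cube b) (cube b * 8048)) ⟩
    cube b * 16512 + 16 * cube b + cube b * 8048 + 2 * n ≡⟨ lem₂ (cube b) n ⟩
    6 * (cube b * 4096) + 2 * n                         ≤⟨ +-monoˡ-≤ (2 * n) (*-monoʳ-≤ 6 lower) ⟩
    6 * n + 2 * n                                       ≡⟨ *-distribʳ-+ n 6 2 ⟨
    8 * n                                               ∎))
    where
    open ≤-Reasoning
    lem₁ : ∀ b q → 8 * (2 * (b * b * (b * 8) + suc q * b) + b * (b * b) * 2048) ≡
                   b * (b * b) * 16512 + 16 * b + 2 * (q * (b * 8))
    lem₁ = solve-∀
    lem₂ : ∀ c n → c * 16512 + 16 * c + c * 8048 + 2 * n ≡ 6 * (c * 4096) + 2 * n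
    lem₂ = solve-∀

  open Bound (b * b) nb (n ∸ T) D′ D≡ blocks room large

  failing : Vec (Fin n) n → ℕ
  failing = fails T (b * b) [] [] (allFin n)

  -- Of the gain `2 ^ y`, one factor `4 ^ (b * b)` cancels the initial weight and the other remains.
  few-failing : ∑ (perms n) failing * 4 ^ (b * b) ≤ n ! * 2
  few-failing = *-cancelʳ-≤ _ _ (D′ ^ T * 4 ^ (b * b)) {{m*n≢0 (D′ ^ T) (4 ^ (b * b)) {{m^n≢0 D′ T {{D′≢0}}}} {{m^n≢0 4 (b * b)}}}} (begin
    f * 4 ^ (b * b) * (D′ ^ T * 4 ^ (b * b))         ≡⟨ lem₁ f (4 ^ (b * b)) (D′ ^ T) ⟩
    f * (4 ^ (b * b) * 4 ^ (b * b) * D′ ^ T)         ≡⟨ cong (λ x → f * (x * D′ ^ T)) 2^y≡ ⟨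
    f * (2 ^ y * D′ ^ T)                             ≤⟨ *-monoʳ-≤ f (2^y*d^≤ D′ y) ⟩
    f * suc D′ ^ T                                   ≤⟨ few-fails {T} (≤-reflexive (m+[n∸m]≡n T≤n)) ⟩
    n ! * (D′ ^ T * (4 ^ (b * b) * 2))               ≡⟨ lem₂ (n !) (D′ ^ T) (4 ^ (b * b)) ⟩
    n ! * 2 * (D′ ^ T * 4 ^ (b * b))                 ∎)
    where
    open ≤-Reasoning
    f = ∑ (perms n) failing
    D′≢0 : NonZero D′
    D′≢0 = >-nonZero (≤-pred (≤-trans (s≤s (s≤s z≤n)) (≤-trans (*-monoʳ-≤ 4 (*-monoˡ-≤ 128 b>0)) (≤-reflexive (sym D≡)))))
    lem₁ : ∀ f p d → f * p * (d * p) ≡ f * (p * p * d)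
    lem₁ = solve-∀
    lem₂ : ∀ f d p → f * (d * (p * 2)) ≡ f * 2 * (d * p)
    lem₂ = solve-∀
    2^y≡ : 2 ^ y ≡ 4 ^ (b * b) * 4 ^ (b * b)
    2^y≡ = trans (sym (^-*-assoc 2 4 (b * b))) (^-distribʳ-* (b * b) 4 4)

  ¬failing⇒twins : ∀ π → failing π ≡ 0 → Twins π (b * b)
  ¬failing⇒twins = ¬fails⇒twins T (b * b)

-- A union bound: each failure takes at most `n ! / (4 m)` permutations, together at most half of
-- what is allowed. Positivity of `n !` makes the inequality strict.
probAbove-of-few : ∀ n k m {E : Vec (Fin n) n → Set} (fail : Vec (Fin n) n → ℕ) →
  length (filter (twins? k) (perms n)) * (4 * m) ≤ n ! →
  ∑ (perms n) fail * (4 * m) ≤ n ! →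
  (∀ {π} → ¬ Twins π k → fail π ≡ 0 → E π) →
  ProbAbove m n E
probAbove-of-few n k m {E} fail few-twin few-fail good =
  L , Unique.filter⁺ ok? (perms-unique n) ,
  All.tabulate (λ π∈ → ∈-perms⁻ (proj₁ (∈L π∈))) ,
  All.tabulate (λ π∈ → good (proj₁ (proj₂ (∈L π∈))) (proj₂ (proj₂ (∈L π∈)))) ,
  ≰⇒> (λ n!≤ → <⇒≱ (m<m+n (n !) (≤-trans (1≤n! n) (≤-reflexive (sym (+-identityʳ (n !)))))) (twice n!≤))
  where
  open ≤-Reasoning
  ok? : Decidable (λ (π : Vec (Fin n) n) → ¬ Twins π k × fail π ≡ 0)
  ok? π = ¬? (twins? k π) ×-dec (fail π ≟ 0)
  L = filter ok? (perms n)
  x = length (filter (twins? k) (perms n))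
  f = ∑ (perms n) fail
  ∈L : ∀ {π} → π ∈ L → π ∈ perms n × ¬ Twins π k × fail π ≡ 0
  ∈L = ∈-filter⁻ ok? {xs = perms n}
  cover : ∀ {P : Set} {z} (ok? : Dec (¬ P × z ≡ 0)) (P? : Dec P) → 1 ≤ ind ok? + (ind P? + z)
  cover         (yes _)  P?      = s≤s z≤n
  cover         (no _)   (yes _) = s≤s z≤n
  cover {z = 0} (no ¬ok) (no ¬p) = contradiction (¬p , refl) ¬ok
  cover {z = suc _} (no _) (no _) = s≤s z≤n
  total : n ! ≤ length L + (x + f)
  total = begin
    n !                                                              ≡⟨ length-perms n ⟨
    length (perms n)                                                 ≡⟨ length-∑ (perms n) ⟩
    ∑ (perms n) (λ _ → 1)                                            ≤⟨ ∑-mono (perms n) (λ {π} _ → cover (ok? π) (twins? k π)) ⟩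
    ∑ (perms n) (λ π → ind (ok? π) + (ind (twins? k π) + fail π))    ≡⟨ trans (∑-distrib-+ (perms n) _ _)
                                                                         (cong (∑ (perms n) (ind ∘ ok?) +_) (∑-distrib-+ (perms n) _ _)) ⟩
    ∑ (perms n) (ind ∘ ok?) + (∑ (perms n) (ind ∘ twins? k) + f)     ≡⟨ cong₂ (λ a b → a + (b + f)) (length-filter-∑ ok? (perms n))
                                                                         (length-filter-∑ (twins? k) (perms n)) ⟨
    length L + (x + f)                                               ∎
  twice : n ! ≤ m * (n ! ∸ length L) → n ! + (n ! + 0) ≤ n !
  twice n!≤ = *-cancelˡ-≤ 2 (begin
    2 * (2 * n !)                       ≤⟨ *-monoʳ-≤ 2 (*-monoʳ-≤ 2 n!≤) ⟩
    2 * (2 * (m * (n ! ∸ length L)))    ≤⟨ *-monoʳ-≤ 2 (*-monoʳ-≤ 2 (*-monoʳ-≤ m (m≤n+o⇒m∸n≤o (n !) (length L) total))) ⟩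
    2 * (2 * (m * (x + f)))             ≡⟨ lem m x f ⟩
    x * (4 * m) + f * (4 * m)           ≤⟨ +-mono-≤ few-twin few-fail ⟩
    n ! + n !                           ≡⟨ cong (n ! +_) (+-identityʳ (n !)) ⟨
    2 * n !                             ∎)
    where
    lem : ∀ m x f → 2 * (2 * (m * (x + f))) ≡ x * (4 * m) + f * (4 * m)
    lem = solve-∀

-- The exponents are compared without the logarithm, as base 2 may be enlarged to `n`. Squaring
-- `n ≤ cube b * c` brings in the cube of `b * b`, hence the condition on `c * c`.
goodEvent : ∀ {n q b κ c} (π : Vec (Fin n) n) → 2 ≤ n → cube q ≤ 128 * (n * n) → n ≤ cube b * c →
  c * c ≤ κ ^ 3 → ¬ Twins π (suc q) → Twins π (b * b) → GoodEvent κ 6 n π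
goodEvent {n} {q} {b} {κ} {c} π 2≤n q³≤ n≤ c²≤ ¬tw tw =
  t , proj₂ (twinNumber π) , ≤-trans (^-monoˡ-≤ (n ^ 2) 2≤n) (^-monoʳ-≤ n {{>-nonZero (≤-trans (s≤s z≤n) 2≤n)}} lower) , upper
  where
  open ≤-Reasoning
  t = proj₁ (twinNumber π)
  t≤q : t ≤ q
  t≤q = ≮⇒≥ (λ q<t → ¬tw (twins-shorten q<t (proj₁ (proj₂ (twinNumber π)))))
  b²≤t : b * b ≤ t
  b²≤t = proj₂ (proj₂ (twinNumber π)) (b * b) tw
  upper : t ^ 3 ≤ 6 ^ 3 * n ^ 2
  upper = begin
    t ^ 3              ≡⟨ cube≡^3 t ⟨
    cube t             ≤⟨ cube-mono t q t≤q ⟩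
    cube q             ≤⟨ q³≤ ⟩
    -- 6 is the least integer whose cube is at least 128.
    128 * (n * n)      ≤⟨ *-monoˡ-≤ (n * n) (m≤m+n 128 88) ⟩
    216 * (n * n)      ≡⟨ cong (λ x → 216 * (n * x)) (*-identityʳ n) ⟨
    6 ^ 3 * n ^ 2      ∎
  lower : n ^ 2 ≤ κ ^ 3 * t ^ 3
  lower = begin
    n ^ 2                            ≡⟨ cong (n *_) (*-identityʳ n) ⟩
    n * n                            ≤⟨ *-mono-≤ n≤ n≤ ⟩
    cube b * c * (cube b * c)        ≡⟨ lem b c ⟩
    c * c * cube (b * b)             ≤⟨ *-mono-≤ c²≤ (cube-mono (b * b) t b²≤t) ⟩
    κ ^ 3 * cube t                   ≡⟨ cong (κ ^ 3 *_) (cube≡^3 t) ⟩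
    κ ^ 3 * t ^ 3                    ∎
    where
    lem : ∀ b c → b * (b * b) * c * (b * (b * b) * c) ≡ c * c * (b * b * (b * b * (b * b)))
    lem = solve-∀

-- `b` and `q` are integer cube roots of `n / 4096` and `128 * (n * n)`. The bound on `n` gives
-- `8 * m ≤ b` and `4 * m ≤ suc q`, so both exponentially small proportions are at most `1 / (4 m)`.
probAbove-between : ∀ m n b q → 0 < m → cube (8 * m) * 4096 ≤ n →
  cube b * 4096 ≤ n → n < cube (suc b) * 4096 →
  cube q ≤ 128 * (n * n) → 128 * (n * n) < cube (suc q) →
  ProbAbove m n (GoodEvent 1024 6 n)
probAbove-between m n b q m>0 N≤n lower n<[1+b]³ q³≤ n²<[1+q]³ =
  probAbove-of-few n (suc q) m failing
    (≤-trans (*-monoʳ-≤ x (≤-trans 4m≤ (n≤2^n (suc q))))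
      (few-twins {n} {suc q} {x} {{>-nonZero n>0}} (<⇒≤ n²<[1+q]³) (count-twins {n} {suc q} (twins? (suc q)))))
    (*-cancelʳ-≤ _ _ 2 (begin
      f * (4 * m) * 2      ≡⟨ lem₁ f m ⟩
      f * (8 * m)          ≤⟨ *-monoʳ-≤ f (≤-trans 8m≤b b≤4^bb) ⟩
      f * 4 ^ (b * b)      ≤⟨ few-failing ⟩
      n ! * 2              ∎))
    -- `≤-refl` checks that the square of 32768 is the cube of 1024, both being the 30th power of 2.
    (λ {π} ¬tw ok → goodEvent {n} {q} {b} {1024} {32768} π n≥2 q³≤ upper ≤-refl ¬tw (¬failing⇒twins π ok))
  where
  open ≤-Reasoning
  lem₁ : ∀ f m → f * (4 * m) * 2 ≡ f * (8 * m)
  lem₁ = solve-∀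
  N≥ : 8 * m ≤ n
  N≥ = ≤-trans (≤-trans (x≤cube (8 * m)) (m≤m*n (cube (8 * m)) 4096)) N≤n
  8m≥8 : 8 ≤ 8 * m
  8m≥8 = m≤m*n 8 m {{>-nonZero m>0}}
  n≥2 : 2 ≤ n
  n≥2 = ≤-trans (m≤m+n 2 6) (≤-trans 8m≥8 N≥)
  n>0 : 0 < n
  n>0 = ≤-trans (s≤s z≤n) n≥2
  8m≤b : 8 * m ≤ b
  8m≤b = ≮⇒≥ (λ b<8m → n≮n n (begin-strict
    n                         <⟨ n<[1+b]³ ⟩
    cube (suc b) * 4096       ≤⟨ *-monoˡ-≤ 4096 (cube-mono (suc b) (8 * m) b<8m) ⟩
    cube (8 * m) * 4096       ≤⟨ N≤n ⟩
    n                         ∎))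
  b>0 : 0 < b
  b>0 = ≤-trans (s≤s z≤n) (≤-trans 8m≥8 8m≤b)
  b≤4^bb : b ≤ 4 ^ (b * b)
  b≤4^bb = ≤-trans (m≤m*n b b {{>-nonZero b>0}}) (≤-trans (n≤2^n (b * b)) (^-monoˡ-≤ (b * b) (m≤m+n 2 2)))
  4m≤ : 4 * m ≤ suc q
  4m≤ = ≮⇒≥ (λ 1+q<4m → <⇒≱ n²<[1+q]³ (begin
    cube (suc q)              ≤⟨ cube-mono (suc q) (8 * m) (≤-trans (<⇒≤ 1+q<4m) (*-monoˡ-≤ m (m≤m+n 4 4))) ⟩
    cube (8 * m)              ≤⟨ m≤m*n (cube (8 * m)) 4096 ⟩
    cube (8 * m) * 4096       ≤⟨ N≤n ⟩
    n                         ≤⟨ m≤m*n n n {{>-nonZero n>0}} ⟩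
    n * n                     ≤⟨ m≤n*m (n * n) 128 ⟩
    128 * (n * n)             ∎))
  upper : n ≤ cube b * 32768
  upper = begin
    n                         ≤⟨ <⇒≤ n<[1+b]³ ⟩
    -- Since `suc b ≤ b + b`, rounding the root costs at most a factor 8.
    cube (suc b) * 4096       ≤⟨ *-monoˡ-≤ 4096 (cube-mono (suc b) (b + b) (+-monoˡ-≤ b b>0)) ⟩
    cube (b + b) * 4096       ≡⟨ lem₂ b ⟩
    cube b * 32768            ∎
    where
    lem₂ : ∀ b → (b + b) * ((b + b) * (b + b)) * 4096 ≡ b * (b * b) * 32768
    lem₂ = solve-∀
  open Scan n b b>0 lower upper
  x = length (filter (twins? (suc q)) (perms n))
  f = ∑ (perms n) failing

probAbove : ∀ m n → 0 < m → cube (8 * m) * 4096 ≤ n → ProbAbove m n (GoodEvent 1024 6 n)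
probAbove m n m>0 N≤n =
  let b , lower , n<  = bracket (λ b → cube b * 4096) {n} z≤n (suc n)
                          (≤-trans (x≤cube (suc n)) (m≤m*n (cube (suc n)) 4096))
      q , q³≤ , n²<   = bracket cube {128 * (n * n)} z≤n (suc (128 * (n * n))) (x≤cube _)
  in probAbove-between m n b q m>0 N≤n lower n< q³≤ n²<

theorem2p2 : ∃ λ k → ∃ λ C → 0 < k × 0 < C ×
    (∀ m → 0 < m → ∃ λ N → ∀ n → N ≤ n → ProbAbove m n (GoodEvent k C n))
theorem2p2 = 1024 , 6 , s≤s z≤n , s≤s z≤n , λ m m>0 →
  cube (8 * m) * 4096 , λ n → probAbove m n m>0
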